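{- Let $K \subsetneq L$ be a field extension with at least one proper nontrivial intermediate field of finite $K$-dimension (that is, an intermediate field $F$ with $K\subsetneq F\subsetneq L$ and $[F:K]<\infty$). Let $n$ be a positive integer such that $$n_0(K,L) \leq n < [L:K].$$ Then there exist $n$-dimensional $K$-subspaces $A,B \subseteq L$ with $1 \notin B$ such that $(A,B)$ is an unmatchable pair if and only if there exists an intermediate extension $K \subsetneq F \subseteq L$ with $[F:K] \leq n$ and $[F:K] \nmid (n+1)$.
   Context: Let $K\subsetneq L$ be a field extension and let $A,B$ be $n$-dimensional $K$-subspaces of $L$ with $n>0$. For a subset $X$ of $L$, $\langle X\rangle$ denotes the $K$-subspace of $L$ spanned by $X$. An ordered basis $\{a_1,\ldots,a_n\}$ of $A$ is matched to an ordered basis $\{b_1,\ldots,b_n\}$ of $B$ if, for each $i\in\{1,\ldots,n\}$, $a_i^{ -1}A\cap B\subseteq \langle b_1,\ldots,b_{i-1},b_{i+1},\ldots,b_n\rangle$. The subspace $A$ is matched to $B$ (equivalently, the pair $(A,B)$ is matchable) if every ordered basis of $A$ can be matched to some ordered basis of $B$; otherwise $(A,B)$ is unmatchable. For an intermediate field $F$ of $K\subseteq L$, $[F:K]$ denotes the $K$-dimension of $F$. The number $n_0(K,L)$ is the minimum of $[F:K]$ over all intermediate fields $K\subsetneq F\subseteq L$ with $[F:K]<\infty$. The degree $[L:K]$ may be infinite, in which case the condition $n<[L:K]$ holds for every integer $n$. -}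

module Defs where

open import Algebra.Bundles using (CommutativeRing)
open import Algebra.Core using (Op₁)
import Algebra.Properties.CommutativeMonoid.Sum as Sum
open import Axiom.ExcludedMiddle using (ExcludedMiddle)
open import Data.Fin.Base using (Fin)
open import Data.Nat.Base using (ℕ; _≤_)
open import Data.Product using (∃; ∃₂; _×_)
open import Data.Vec.Functional using (Vector)
open import Level using (Level; _⊔_; suc; Setω)
open import Relation.Binary.Definitions using (_Respects_)
open import Relation.Binary.PropositionalEquality using (_≢_)
open import Relation.Nullary using (¬_)
open import Relation.Unary using (Pred; _∈_; _⊆_; _⊂_; _≐_; _∩_)

-- The mathematics is classical: this is taken as an explicit hypothesis.
Classical : Setω
Classical = ∀ {a} → ExcludedMiddle a

-- `_⁻¹` is total, with an unconstrained value at 0#. Classically every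
-- field carries such an operation.
record Field c ℓ : Set (suc (c ⊔ ℓ)) where
  infix 9 _⁻¹
  field
    commutativeRing : CommutativeRing c ℓ
  open CommutativeRing commutativeRing public
  field
    _⁻¹      : Op₁ Carrier
    0≉1      : 0# ≉ 1#
    ⁻¹-inverseˡ : ∀ x → x ≉ 0# → x ⁻¹ * x ≈ 1#

  -- Subsets of a setoid are predicates; those meant to be closed under the
  -- setoid equality say so (`resp` below). All subsets that get quantified
  -- over live at one level, which is no restriction classically.
  Subset : Set (suc (c ⊔ ℓ))
  Subset = Pred Carrier (c ⊔ ℓ)

  record IsSubfield (F : Subset) : Set (c ⊔ ℓ) where
    field
      resp      : F Respects _≈_
      0∈        : 0# ∈ F
      1∈        : 1# ∈ F
      +-closed  : ∀ {x y} → x ∈ F → y ∈ F → x + y ∈ F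
      -‿closed  : ∀ {x} → x ∈ F → - x ∈ F
      *-closed  : ∀ {x y} → x ∈ F → y ∈ F → x * y ∈ F
      ⁻¹-closed : ∀ {x} → x ∈ F → x ≉ 0# → x ⁻¹ ∈ F

-- An extension K ⊆ L, with K given as a subfield of L.
record FieldExtension c ℓ : Set (suc (c ⊔ ℓ)) where
  field
    L : Field c ℓ
  open Field L public
  field
    K          : Subset
    isSubfield : IsSubfield K

  open Sum +-commutativeMonoid using (sum)

  private variable
    p : Level

  record IsSubspace (V : Subset) : Set (c ⊔ ℓ) where
    field
      resp     : V Respects _≈_
      0∈       : 0# ∈ V
      +-closed : ∀ {x y} → x ∈ V → y ∈ V → x + y ∈ V
      *-closed : ∀ {k x} → k ∈ K → x ∈ V → k * x ∈ V

  -- The K-span of a subset: all finite K-linear combinations of its elements.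
  ⟨_⟩ : Pred Carrier p → Pred Carrier (c ⊔ ℓ ⊔ p)
  ⟨ X ⟩ x = ∃ λ (m : ℕ) → ∃₂ λ (k v : Vector Carrier m) →
    (∀ i → k i ∈ K) × (∀ i → v i ∈ X) × x ≈ sum (λ i → k i * v i)

  range : ∀ {n} → Vector Carrier n → Pred Carrier ℓ
  range v x = ∃ λ i → x ≈ v i

  rangeExcept : ∀ {n} → Fin n → Vector Carrier n → Pred Carrier ℓ
  rangeExcept i v x = ∃ λ j → j ≢ i × x ≈ v j

  LinearlyIndependent : ∀ {n} → Vector Carrier n → Set (c ⊔ ℓ)
  LinearlyIndependent {n} v = (k : Vector Carrier n) → (∀ i → k i ∈ K) →
    sum (λ i → k i * v i) ≈ 0# → ∀ i → k i ≈ 0#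

  IsBasis : ∀ {n} → Vector Carrier n → Pred Carrier p → Set (c ⊔ ℓ ⊔ p)
  IsBasis v V = LinearlyIndependent v × ⟨ range v ⟩ ≐ V

  HasDim : Pred Carrier p → ℕ → Set (c ⊔ ℓ ⊔ p)
  HasDim V n = ∃ λ (v : Vector Carrier n) → IsBasis v V

  -- F is an intermediate field with K ⊊ F ⊆ L and [F:K] = d.
  IsProperExtensionOfDegree : Subset → ℕ → Set (c ⊔ ℓ)
  IsProperExtensionOfDegree F d = IsSubfield F × K ⊂ F × HasDim F d

  -- n₀ is the number n₀(K,L).
  IsMinimalDegree : ℕ → Set (suc (c ⊔ ℓ))
  IsMinimalDegree n₀ =
    (∃ λ F → IsProperExtensionOfDegree F n₀) ×
    (∀ F d → IsProperExtensionOfDegree F d → n₀ ≤ d)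

  infixr 8 _·_
  _·_ : Carrier → Subset → Subset
  (x · A) y = ∃ λ a → a ∈ A × y ≈ x * a

  BasisMatched : ∀ {n} → Subset → Subset →
                 Vector Carrier n → Vector Carrier n → Set (c ⊔ ℓ)
  BasisMatched A B a b =
    ∀ i → ((a i) ⁻¹ · A) ∩ B ⊆ ⟨ rangeExcept i b ⟩

  Matchable : ℕ → Subset → Subset → Set (c ⊔ ℓ)
  Matchable n A B = (a : Vector Carrier n) → IsBasis a A →
    ∃ λ (b : Vector Carrier n) → IsBasis b B × BasisMatched A B a b

  Unmatchable : ℕ → Subset → Subset → Set (c ⊔ ℓ)
  Unmatchable n A B = ¬ Matchable n A B

{-# OPTIONS --safe #-}
module Submission where

-- By Rado's theorem, applied to the annihilators of the subspaces aᵢ⁻¹A ∩ B in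
-- the dual of B, a basis a of A can be matched to B unless some J has
-- dim ⋂_{i ∈ J} (aᵢ⁻¹A ∩ B) > n - |J|. In that case A₀ = ⟨aᵢ | i ∈ J⟩ and
-- B₁ = K + ⋂_{i ∈ J} (aᵢ⁻¹A ∩ B) satisfy A₀B₁ ⊆ A, and since 1 ∉ B their
-- dimensions add up to at least n + 2. Dyson's e-transform replaces them by
-- S ⊆ A and B′ with SB′ ⊆ S and the same sum of dimensions. The stabilizer F
-- of S is then a field containing B′ whose degree d divides dim S, where
-- n + 2 - d ≤ dim S ≤ n, so d does not divide n + 1. The converse is an
-- explicit construction.

open import Defs
open import Data.Nat.Base using (ℕ; suc; _≤_; _<_; s≤s)
import Data.Nat.Base as ℕ
open import Data.Nat.Divisibility using (_∣_; _∤_; divides; m%n≡0⇒n∣m)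
open import Data.Nat.DivMod using (_/_; _%_; m≡m%n+[m/n]*n; m%n<n)
import Data.Nat.Properties as ℕₚ
open import Data.Fin.Base using (Fin; zero; suc)
import Data.Fin.Subset as FS
import Data.Fin.Subset.Properties as FSₚ
open import Data.Fin.Properties using (punchInᵢ≢i; suc-injective)
import Data.Fin.Properties as Fin
open import Data.Sum.Base using (_⊎_; inj₁; inj₂; [_,_])
open import Data.Unit.Base using (⊤)
open import Data.Vec.Base using ([]; _∷_; here; there)
open import Data.Vec.Functional using (Vector; tail; removeAt) renaming ([] to []ᶠ; _∷_ to _∷ᶠ_)
open import Data.Product using (∃; ∃₂; _×_; _,_; proj₁; proj₂)
open import Level using (_⊔_; Lift; lift; lower)
open import Relation.Binary.PropositionalEquality as ≡ using (_≡_; _≢_)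
open import Relation.Nullary using (¬_; yes; no; contradiction)
open import Relation.Nullary.Decidable using (decidable-stable)
open import Relation.Unary using (_∈_; _∉_; _⊆_; _⊂_; U)

-- The code works in B and not in its dual. For a basis b of B with dual basis bᵢ*, the functional
-- bᵢ* annihilates a subspace W of B exactly when W lies in the span of the bⱼ with j ≠ i. Being
-- matched to b therefore says that the bᵢ* form an independent transversal of the annihilators, and
-- Rado's condition, that the annihilators for i ∈ J span at least |J| dimensions, turns into the
-- bound n - |J| on the dimension of the intersection. A violation alone yields dimensions with sum
-- at least n + 1. The line K, adjoined to the intersection because 1 ∉ B, supplies the missing
-- dimension; it also puts 1 into the right factor, which keeps the left factor inside A throughout
-- the e-transform.

module Subspaces (em : Classical) {c ℓ} (E : FieldExtension c ℓ) where

  open FieldExtension E hiding (zero)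
  open import Algebra.Properties.Ring ring using (-1*x≈-x)
  open import Algebra.Properties.CommutativeSemigroup +-commutativeSemigroup using (interchange)
  open import Algebra.Properties.CommutativeSemigroup *-commutativeSemigroup using (x∙yz≈y∙xz)
  open import Algebra.Properties.CommutativeMonoid.Sum +-commutativeMonoid using (sum; sum-remove)
  module K = IsSubfield isSubfield

  -- Subspaces of L over K and their lattice

  record Subspace : Set (Level.suc (c ⊔ ℓ)) where
    no-eta-equality
    field
      ⟦_⟧        : Subset
      isSubspace : IsSubspace ⟦_⟧
    open IsSubspace isSubspace public

    cancelˡ : ∀ {x y} → x ∈ ⟦_⟧ → x + y ∈ ⟦_⟧ → y ∈ ⟦_⟧
    cancelˡ {x} {y} x∈ x+y∈ = resp eq (+-closed (*-closed (K.-‿closed K.1∈) x∈) x+y∈)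
      where
      eq : - 1# * x + (x + y) ≈ y
      eq = trans (sym (+-assoc _ _ _))
        (trans (+-congʳ (trans (+-congʳ (-1*x≈-x x)) (-‿inverseˡ x))) (+-identityˡ y))

    cancelʳ : ∀ {x y} → y ∈ ⟦_⟧ → x + y ∈ ⟦_⟧ → x ∈ ⟦_⟧
    cancelʳ y∈ x+y∈ = cancelˡ y∈ (resp (+-comm _ _) x+y∈)

    *-cancel : ∀ {k x} → k ∈ K → k ≉ 0# → k * x ∈ ⟦_⟧ → x ∈ ⟦_⟧
    *-cancel k∈ k≉0 kx∈ = resp
      (trans (sym (*-assoc _ _ _)) (trans (*-congʳ (⁻¹-inverseˡ _ k≉0)) (*-identityˡ _)))
      (*-closed (K.⁻¹-closed k∈ k≉0) kx∈)

    coefficient≈0 : ∀ {k x} → k ∈ K → k * x ∈ ⟦_⟧ → x ∉ ⟦_⟧ → k ≈ 0#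
    coefficient≈0 {k} k∈ kx∈ x∉ with em {P = k ≈ 0#}
    ... | yes k≈0 = k≈0
    ... | no  k≉0 = contradiction (*-cancel k∈ k≉0 kx∈) x∉

  open Subspace using (⟦_⟧)

  infix 4 _⊑_
  -- A record, so that V and W can be recovered from the type of a proof; the unfolded inclusion of
  -- predicates would lose them.
  record _⊑_ (V W : Subspace) : Set (c ⊔ ℓ) where
    constructor incl
    field app : ⟦ V ⟧ ⊆ ⟦ W ⟧
  open _⊑_

  ⊑-refl : ∀ {V} → V ⊑ V
  ⊑-refl = incl λ x∈ → x∈

  ⊑-trans : ∀ {V W X} → V ⊑ W → W ⊑ X → V ⊑ X
  ⊑-trans p q = incl λ x∈ → app q (app p x∈)

  ¬⊑⇒∃ : ∀ {V W} → ¬ (V ⊑ W) → ∃ λ x → x ∈ ⟦ V ⟧ × x ∉ ⟦ W ⟧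
  ¬⊑⇒∃ {V} {W} V⋢W with em {P = ∃ λ x → x ∈ ⟦ V ⟧ × x ∉ ⟦ W ⟧}
  ... | yes p = p
  ... | no ¬p = contradiction (incl sub) V⋢W
    where
    sub : ⟦ V ⟧ ⊆ ⟦ W ⟧
    sub {x} x∈ with em {P = x ∈ ⟦ W ⟧}
    ... | yes q = q
    ... | no ¬q = contradiction (x , x∈ , ¬q) ¬p

  𝟎 : Subspace
  𝟎 .Subspace.⟦_⟧ x = Lift c (x ≈ 0#)
  𝟎 .Subspace.isSubspace = record
    { resp     = λ x≈y (lift x≈0) → lift (trans (sym x≈y) x≈0)
    ; 0∈       = lift refl
    ; +-closed = λ (lift p) (lift q) → lift (trans (+-cong p q) (+-identityˡ 0#))
    ; *-closed = λ _ (lift p) → lift (trans (*-congˡ p) (zeroʳ _))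
    }

  𝟎⊑ : ∀ V → 𝟎 ⊑ V
  𝟎⊑ V = incl λ (lift x≈0) → Subspace.resp V (sym x≈0) (Subspace.0∈ V)

  infixr 6 _∧_
  _∧_ : Subspace → Subspace → Subspace
  (V ∧ W) .Subspace.⟦_⟧ x = x ∈ ⟦ V ⟧ × x ∈ ⟦ W ⟧
  (V ∧ W) .Subspace.isSubspace = record
    { resp     = λ x≈y (p , q) → V.resp x≈y p , W.resp x≈y q
    ; 0∈       = V.0∈ , W.0∈
    ; +-closed = λ (p , q) (p′ , q′) → V.+-closed p p′ , W.+-closed q q′
    ; *-closed = λ k∈ (p , q) → V.*-closed k∈ p , W.*-closed k∈ q
    }
    where
    module V = Subspace V
    module W = Subspace W

  ∧-⊑ˡ : ∀ {V W} → V ∧ W ⊑ V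
  ∧-⊑ˡ = incl proj₁

  ∧-⊑ʳ : ∀ {V W} → V ∧ W ⊑ W
  ∧-⊑ʳ = incl proj₂

  ∧-greatest : ∀ {V W X} → X ⊑ V → X ⊑ W → X ⊑ V ∧ W
  ∧-greatest p q = incl λ x∈ → app p x∈ , app q x∈

  infixr 5 _∨_
  _∨_ : Subspace → Subspace → Subspace
  (V ∨ W) .Subspace.⟦_⟧ x = ∃₂ λ v w → v ∈ ⟦ V ⟧ × w ∈ ⟦ W ⟧ × x ≈ v + w
  (V ∨ W) .Subspace.isSubspace = record
    { resp     = λ x≈y (v , w , v∈ , w∈ , eq) → v , w , v∈ , w∈ , trans (sym x≈y) eq
    ; 0∈       = 0# , 0# , V.0∈ , W.0∈ , sym (+-identityˡ 0#)
    ; +-closed = λ (v , w , v∈ , w∈ , eq) (v′ , w′ , v′∈ , w′∈ , eq′) →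
        v + v′ , w + w′ , V.+-closed v∈ v′∈ , W.+-closed w∈ w′∈ ,
        trans (+-cong eq eq′) (interchange v w v′ w′)
    ; *-closed = λ {k} k∈ (v , w , v∈ , w∈ , eq) →
        k * v , k * w , V.*-closed k∈ v∈ , W.*-closed k∈ w∈ ,
        trans (*-congˡ eq) (distribˡ k v w)
    }
    where
    module V = Subspace V
    module W = Subspace W

  ⊑-∨ˡ : ∀ {V W} → V ⊑ V ∨ W
  ⊑-∨ˡ {V} {W} = incl λ {x} x∈ → x , 0# , x∈ , Subspace.0∈ W , sym (+-identityʳ x)

  ⊑-∨ʳ : ∀ {V W} → W ⊑ V ∨ W
  ⊑-∨ʳ {V} {W} = incl λ {x} x∈ → 0# , x , Subspace.0∈ V , x∈ , sym (+-identityˡ x)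

  ∨-least : ∀ {V W X} → V ⊑ X → W ⊑ X → V ∨ W ⊑ X
  ∨-least {X = X} p q = incl λ (v , w , v∈ , w∈ , eq) →
    X.resp (sym eq) (X.+-closed (app p v∈) (app q w∈))
    where module X = Subspace X

  infixl 5 _▹_
  _▹_ : Subspace → Carrier → Subspace
  (V ▹ x) .Subspace.⟦_⟧ y = ∃₂ λ v k → v ∈ ⟦ V ⟧ × k ∈ K × y ≈ v + k * x
  (V ▹ x) .Subspace.isSubspace = record
    { resp     = λ y≈z (v , k , v∈ , k∈ , eq) → v , k , v∈ , k∈ , trans (sym y≈z) eq
    ; 0∈       = 0# , 0# , V.0∈ , K.0∈ , sym (trans (+-identityˡ _) (zeroˡ x))
    ; +-closed = λ (v , k , v∈ , k∈ , eq) (v′ , k′ , v′∈ , k′∈ , eq′) →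
        v + v′ , k + k′ , V.+-closed v∈ v′∈ , K.+-closed k∈ k′∈ ,
        trans (+-cong eq eq′)
          (trans (interchange v (k * x) v′ (k′ * x)) (+-congˡ (sym (distribʳ x k k′))))
    ; *-closed = λ {l} l∈ (v , k , v∈ , k∈ , eq) →
        l * v , l * k , V.*-closed l∈ v∈ , K.*-closed l∈ k∈ ,
        trans (*-congˡ eq) (trans (distribˡ l v _) (+-congˡ (sym (*-assoc l k x))))
    }
    where module V = Subspace V

  ⊑-▹ : ∀ {V x} → V ⊑ V ▹ x
  ⊑-▹ {V} {x} = incl λ {v} v∈ →
    v , 0# , v∈ , K.0∈ , sym (trans (+-congˡ (zeroˡ x)) (+-identityʳ v))

  ∈-▹ : ∀ {V x} → x ∈ ⟦ V ▹ x ⟧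
  ∈-▹ {V} {x} = 0# , 1# , Subspace.0∈ V , K.1∈ , sym (trans (+-identityˡ _) (*-identityˡ x))

  ▹-least : ∀ {V W x} → V ⊑ W → x ∈ ⟦ W ⟧ → V ▹ x ⊑ W
  ▹-least {W = W} V⊑W x∈ = incl λ (v , k , v∈ , k∈ , eq) →
    W.resp (sym eq) (W.+-closed (app V⊑W v∈) (W.*-closed k∈ x∈))
    where module W = Subspace W

  -- For x ≉ 0 this is x⁻¹V; for x ≈ 0 it is everything.
  infixl 7 _÷_
  _÷_ : Subspace → Carrier → Subspace
  (V ÷ x) .Subspace.⟦_⟧ y = x * y ∈ ⟦ V ⟧
  (V ÷ x) .Subspace.isSubspace = record
    { resp     = λ y≈z → V.resp (*-congˡ y≈z)
    ; 0∈       = V.resp (sym (zeroʳ x)) V.0∈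
    ; +-closed = λ p q → V.resp (sym (distribˡ x _ _)) (V.+-closed p q)
    ; *-closed = λ {k} {y} k∈ p → V.resp (x∙yz≈y∙xz k x y) (V.*-closed k∈ p)
    }
    where module V = Subspace V

  -- Chains of subspaces and dimension

  record Step (V W : Subspace) : Set (c ⊔ ℓ) where
    field
      V⊑W   : V ⊑ W
      new   : Carrier
      new∈  : new ∈ ⟦ W ⟧
      new∉  : new ∉ ⟦ V ⟧
      cover : W ⊑ V ▹ new

  step-▹ : ∀ {V x} → x ∉ ⟦ V ⟧ → Step V (V ▹ x)
  step-▹ {V} x∉ = record
    { V⊑W = ⊑-▹ ; new∈ = ∈-▹ {V} ; new∉ = x∉ ; cover = ⊑-refl }

  -- Steinitz exchange: in x = v + k `new` the coefficient k is nonzero because x ∉ V, so `new` can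
  -- be solved for, and x serves equally well.
  exchange : ∀ {V W x} → Step V W → x ∈ ⟦ W ⟧ → x ∉ ⟦ V ⟧ → W ⊑ V ▹ x
  exchange {V} {W} {x} s x∈ x∉ with app (Step.cover s) x∈
  ... | v , k , v∈ , k∈ , eq = ⊑-trans (Step.cover s) (▹-least ⊑-▹ new∈)
    where
    module V▹x = Subspace (V ▹ x)
    k≉0 : k ≉ 0#
    k≉0 k≈0 = x∉ (Subspace.resp V
      (sym (trans eq (trans (+-congˡ (trans (*-congʳ k≈0) (zeroˡ _))) (+-identityʳ v)))) v∈)
    new∈ : Step.new s ∈ ⟦ V ▹ x ⟧
    new∈ = V▹x.*-cancel k∈ k≉0 (V▹x.cancelˡ (app (⊑-▹ {V}) v∈) (V▹x.resp eq (∈-▹ {V})))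

  -- If z = v + kx with z and x in X, then v = z - kx lies in X too, so the covering of W by V and x
  -- restricts to X.
  step-restrict : ∀ {V W X x} → Step V W → X ⊑ W → x ∈ ⟦ X ⟧ → x ∉ ⟦ V ⟧ → Step (X ∧ V) X
  step-restrict {V} {W} {X} {x} s X⊑W x∈ x∉ = record
    { V⊑W = ∧-⊑ˡ ; new∈ = x∈ ; new∉ = λ (_ , x∈V) → x∉ x∈V ; cover = incl cover }
    where
    module X = Subspace X
    cover : ⟦ X ⟧ ⊆ ⟦ X ∧ V ▹ x ⟧
    cover z∈ with app (exchange s (app X⊑W x∈) x∉) (app X⊑W z∈)
    ... | v , k , v∈ , k∈ , eq =
      v , k , (X.cancelʳ (X.*-closed k∈ x∈) (X.resp eq z∈) , v∈) , k∈ , eq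

  -- Chain V W n says dim (W / V) = n without choosing coordinates.
  data Chain (V : Subspace) : Subspace → ℕ → Set (Level.suc (c ⊔ ℓ)) where
    nil  : ∀ {W} → V ⊑ W → W ⊑ V → Chain V W 0
    snoc : ∀ {W X n} → Chain V W n → Step W X → Chain V X (suc n)

  Dim : Subspace → ℕ → Set (Level.suc (c ⊔ ℓ))
  Dim = Chain 𝟎

  chain-⊑ : ∀ {V W n} → Chain V W n → V ⊑ W
  chain-⊑ (nil p _)  = p
  chain-⊑ (snoc c s) = ⊑-trans (chain-⊑ c) (Step.V⊑W s)

  chain-zero : ∀ {V W n} → Chain V W n → W ⊑ V → n ≡ 0
  chain-zero (nil _ _)  _ = ≡.refl
  chain-zero (snoc c s) p =
    contradiction (app (chain-⊑ c) (app p (Step.new∈ s))) (Step.new∉ s)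

  step-respʳ : ∀ {V W X} → Step V W → W ⊑ X → X ⊑ W → Step V X
  step-respʳ s p q = record
    { V⊑W = ⊑-trans V⊑W p ; new∈ = app p new∈ ; new∉ = new∉ ; cover = ⊑-trans q cover }
    where open Step s

  chain-respʳ : ∀ {V W X n} → Chain V W n → W ⊑ X → X ⊑ W → Chain V X n
  chain-respʳ (nil p q)  p′ q′ = nil (⊑-trans p p′) (⊑-trans q′ q)
  chain-respʳ (snoc c s) p q   = snoc c (step-respʳ s p q)

  chain-respˡ : ∀ {V W X n} → Chain V W n → V ⊑ X → X ⊑ V → Chain X W n
  chain-respˡ (nil p q)  p′ q′ = nil (⊑-trans q′ p) (⊑-trans q p′)
  chain-respˡ (snoc c s) p q   = snoc (chain-respˡ c p q) s

  chain-++ : ∀ {V W X m n} → Chain V W m → Chain W X n → Chain V X (n ℕ.+ m)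
  chain-++ c (nil p q)   = chain-respʳ c p q
  chain-++ c (snoc c′ s) = snoc (chain-++ c c′) s

  -- The second isomorphism theorem: W / V ≅ (W + X) / (V + X).
  chain-∨ : ∀ {V W X n} → Chain V W n → W ∧ X ⊑ V → Chain (V ∨ X) (W ∨ X) n
  chain-∨ (nil p q) _ =
    nil (∨-least (⊑-trans p ⊑-∨ˡ) ⊑-∨ʳ) (∨-least (⊑-trans q ⊑-∨ˡ) ⊑-∨ʳ)
  chain-∨ {V} {W} {X} (snoc {W′} c s) W∧X⊑V =
    snoc (chain-∨ c (⊑-trans (∧-greatest (⊑-trans ∧-⊑ˡ V⊑W) ∧-⊑ʳ) W∧X⊑V)) record
      { V⊑W   = ∨-least (⊑-trans V⊑W ⊑-∨ˡ) ⊑-∨ʳ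
      ; new∈  = app (⊑-∨ˡ {W} {X}) new∈
      ; new∉  = λ (v , x , v∈ , x∈ , eq) → new∉ (Subspace.resp W′ (sym eq)
          (Subspace.+-closed W′ v∈ (app (chain-⊑ c) (app W∧X⊑V
            (Subspace.cancelˡ W (app V⊑W v∈) (Subspace.resp W eq new∈) , x∈)))))
      ; cover = ∨-least (⊑-trans cover (▹-least (⊑-trans ⊑-∨ˡ ⊑-▹) (∈-▹ {W′ ∨ X})))
                        (⊑-trans ⊑-∨ʳ ⊑-▹)
      }
    where open Step s

  -- The last step W′ ⊂ W is charged to one of the halves. If X ⊑ W′, it belongs to the upper one.
  -- Otherwise X ∧ W′ is a hyperplane of X and the step belongs to the lower half, while W′ + X = W
  -- and the second isomorphism theorem carries W′ / (X ∧ W′) to W / X.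
  chain-between : ∀ {V W X n} → Chain V W n → V ⊑ X → X ⊑ W →
                  ∃₂ λ i j → Chain V X i × Chain X W j × j ℕ.+ i ≡ n
  chain-between (nil _ W⊑V) V⊑X X⊑W =
    0 , 0 , nil V⊑X (⊑-trans X⊑W W⊑V) , nil X⊑W (⊑-trans W⊑V V⊑X) , ≡.refl
  chain-between {X = X} (snoc {W′} c s) V⊑X X⊑W
    with chain-between c (∧-greatest V⊑X (chain-⊑ c)) (∧-⊑ʳ {X} {W′})
       | em {P = X ⊑ W′}
  ... | i , j , c₁ , c₂ , eq | yes X⊑W′ =
    i , suc j , chain-respʳ c₁ ∧-⊑ˡ X⊑X∧W′ ,
    snoc (chain-respˡ c₂ ∧-⊑ˡ X⊑X∧W′) s , ≡.cong suc eq
    where X⊑X∧W′ = ∧-greatest ⊑-refl X⊑W′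
  ... | i , j , c₁ , c₂ , eq | no X⋢W′ with ¬⊑⇒∃ X⋢W′
  ... | x , x∈X , x∉W′ =
    suc i , j , snoc c₁ (step-restrict s X⊑W x∈X x∉W′) ,
    chain-respʳ (chain-respˡ (chain-∨ c₂ (incl λ (p , q) → q , p))
      (∨-least ∧-⊑ˡ ⊑-refl) ⊑-∨ʳ)
      (∨-least (Step.V⊑W s) X⊑W)
      (⊑-trans (exchange s (app X⊑W x∈X) x∉W′) (▹-least ⊑-∨ˡ (app (⊑-∨ʳ {W′} {X}) x∈X))) ,
    ≡.trans (ℕₚ.+-suc j i) (≡.cong suc eq)

  chain-unique₁ : ∀ {V W n} → Step V W → Chain V W n → n ≡ 1
  chain-unique₁ s (nil _ W⊑V) = contradiction (app W⊑V (Step.new∈ s)) (Step.new∉ s)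
  chain-unique₁ {V} {W} s (snoc {W′} c s′) with em {P = W′ ⊑ V}
  ... | yes W′⊑V = ≡.cong suc (chain-zero c W′⊑V)
  ... | no  W′⋢V with ¬⊑⇒∃ W′⋢V
  ... | x , x∈W′ , x∉V = contradiction
    (app (▹-least (chain-⊑ c) x∈W′) (app (exchange s (app (Step.V⊑W s′) x∈W′) x∉V) (Step.new∈ s′)))
    (Step.new∉ s′)

  -- The second chain is cut at the last hyperplane of the first: the lower piece falls to the
  -- induction, the upper one has length one.
  chain-unique : ∀ {V W m n} → Chain V W m → Chain V W n → m ≡ n
  chain-unique (nil p q) c = ≡.sym (chain-zero c q)
  chain-unique (snoc c s) c′ with chain-between c′ (chain-⊑ c) (Step.V⊑W s)
  ... | i , j , c₁ , c₂ , ≡.refl with chain-unique c c₁ | chain-unique₁ s c₂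
  ... | ≡.refl | ≡.refl = ≡.refl

  chain-one : ∀ {V W} → Chain V W 1 → Step V W
  chain-one {V} (snoc (nil p q) s) = record
    { V⊑W = ⊑-trans p V⊑W ; new∈ = new∈ ; new∉ = λ v∈ → new∉ (app p v∈)
    ; cover = ⊑-trans cover (▹-least (⊑-trans q ⊑-▹) (∈-▹ {V})) }
    where open Step s

  dim-⊑ : ∀ {V W n} → V ⊑ W → Dim W n → ∃ λ m → Dim V m × m ≤ n
  dim-⊑ {V} V⊑W d with chain-between d (𝟎⊑ V) V⊑W
  ... | i , j , c , _ , ≡.refl = i , c , ℕₚ.m≤n+m i j

  dim-≤ : ∀ {V W m n} → V ⊑ W → Dim V m → Dim W n → m ≤ n
  dim-≤ V⊑W d d′ with dim-⊑ V⊑W d′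
  ... | m′ , d″ , m′≤n with chain-unique d d″
  ... | ≡.refl = m′≤n

  codim : ∀ {V W m n} → V ⊑ W → Dim V m → Dim W n → ∃ λ j → Chain V W j × j ℕ.+ m ≡ n
  codim {V} V⊑W d d′ with chain-between d′ (𝟎⊑ V) V⊑W
  ... | i , j , c , c′ , eq with chain-unique d c
  ... | ≡.refl = j , c′ , eq

  dim-≡ : ∀ {V W n} → V ⊑ W → Dim V n → Dim W n → W ⊑ V
  dim-≡ {n = n} V⊑W d d′ with codim V⊑W d d′
  ... | 0 , nil _ W⊑V , _ = W⊑V
  ... | suc j , _ , eq = contradiction (≡.sym eq) (ℕₚ.m≢1+n+m n)

  -- By `chain-∨`, V has the same codimension over V ∧ W as V ∨ W has over W.
  modular : ∀ {V W l m s t} → Dim V l → Dim W m → Dim (V ∧ W) s → Dim (V ∨ W) t →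
            l ℕ.+ m ≡ s ℕ.+ t
  modular {V} {W} {l} {m} {s} dV dW d∧ d∨ with codim (∧-⊑ˡ {V} {W}) d∧ dV
  ... | j , c , ≡.refl
    with chain-unique d∨ (chain-++ dW
           (chain-respˡ (chain-∨ c ⊑-refl) (∨-least ∧-⊑ʳ ⊑-refl) ⊑-∨ʳ))
  ... | ≡.refl = ≡.trans (≡.cong (ℕ._+ m) (ℕₚ.+-comm j s)) (ℕₚ.+-assoc s j m)

  dim-∨ : ∀ {V W m n} → Dim V m → Dim W n → V ∧ W ⊑ 𝟎 → Dim (V ∨ W) (m ℕ.+ n)
  dim-∨ {V} {W} dV dW V∧W⊑𝟎 = chain-++ dW
    (chain-respˡ (chain-∨ dV V∧W⊑𝟎) (∨-least (𝟎⊑ W) ⊑-refl) ⊑-∨ʳ)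

  *-⁻¹-cancelˡ : ∀ {x} y → x ≉ 0# → x * (x ⁻¹ * y) ≈ y
  *-⁻¹-cancelˡ {x} y x≉0 = trans (sym (*-assoc x _ y))
    (trans (*-congʳ (trans (*-comm x _) (⁻¹-inverseˡ x x≉0))) (*-identityˡ y))

  ⁻¹-*-cancelˡ : ∀ {x} y → x ≉ 0# → x ⁻¹ * (x * y) ≈ y
  ⁻¹-*-cancelˡ {x} y x≉0 = trans (sym (*-assoc _ x y))
    (trans (*-congʳ (⁻¹-inverseˡ x x≉0)) (*-identityˡ y))

  ÷-mono : ∀ {V W} x → V ⊑ W → V ÷ x ⊑ W ÷ x
  ÷-mono x p = incl (app p)

  chain-÷ : ∀ {V W n x} → x ≉ 0# → Chain V W n → Chain (V ÷ x) (W ÷ x) n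
  chain-÷ {x = x} x≉0 (nil p q) = nil (÷-mono x p) (÷-mono x q)
  chain-÷ {V} {W} {x = x} x≉0 (snoc {W′} c s) = snoc (chain-÷ x≉0 c) record
    { V⊑W   = ÷-mono x V⊑W
    ; new   = x ⁻¹ * new
    ; new∈  = Subspace.resp W (sym (*-⁻¹-cancelˡ new x≉0)) new∈
    ; new∉  = λ p → new∉ (Subspace.resp W′ (*-⁻¹-cancelˡ new x≉0) p)
    ; cover = incl λ {y} y∈ → let (v , k , v∈ , k∈ , eq) = app cover y∈ in
        x ⁻¹ * v , k , Subspace.resp W′ (sym (*-⁻¹-cancelˡ v x≉0)) v∈ , k∈ ,
        trans (sym (⁻¹-*-cancelˡ y x≉0)) (trans (*-congˡ eq)
          (trans (distribˡ _ v _) (+-congˡ (x∙yz≈y∙xz _ k new))))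
    }
    where open Step s

  dim-÷ : ∀ {V n x} → x ≉ 0# → Dim V n → Dim (V ÷ x) n
  dim-÷ {V} {x = x} x≉0 d = chain-respˡ (chain-÷ x≉0 d) (incl λ {y} (lift xy≈0) →
    lift (trans (sym (⁻¹-*-cancelˡ y x≉0)) (trans (*-congˡ xy≈0) (zeroʳ _)))) (𝟎⊑ _)

  -- Spans, linear independence and bases

  module _ {X : Carrier → Set ℓ} where

    ⟨⟩-∷ : ∀ {k v x} → k ∈ K → v ∈ X → x ∈ ⟨ X ⟩ → k * v + x ∈ ⟨ X ⟩
    ⟨⟩-∷ {k} {v} k∈ v∈ (m , ks , vs , ks∈ , vs∈ , eq) =
      suc m , k ∷ᶠ ks , v ∷ᶠ vs ,
      (λ { zero → k∈ ; (suc i) → ks∈ i }) , (λ { zero → v∈ ; (suc i) → vs∈ i }) , +-congˡ eq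

    ⟨⟩-resp : ∀ {x y} → x ≈ y → x ∈ ⟨ X ⟩ → y ∈ ⟨ X ⟩
    ⟨⟩-resp x≈y (m , ks , vs , ks∈ , vs∈ , eq) =
      m , ks , vs , ks∈ , vs∈ , trans (sym x≈y) eq

    ⟨⟩-0 : 0# ∈ ⟨ X ⟩
    ⟨⟩-0 = 0 , []ᶠ , []ᶠ , (λ ()) , (λ ()) , refl

    sum-∈⟨⟩-+ : ∀ {m x} (k v : Vector Carrier m) → (∀ i → k i ∈ K) → (∀ i → v i ∈ X) →
                x ∈ ⟨ X ⟩ → sum (λ i → k i * v i) + x ∈ ⟨ X ⟩
    sum-∈⟨⟩-+ {0}     k v k∈ v∈ x∈ = ⟨⟩-resp (sym (+-identityˡ _)) x∈
    sum-∈⟨⟩-+ {suc m} k v k∈ v∈ x∈ = ⟨⟩-resp (sym (+-assoc _ _ _))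
      (⟨⟩-∷ (k∈ zero) (v∈ zero)
        (sum-∈⟨⟩-+ (tail k) (tail v) (λ i → k∈ (suc i)) (λ i → v∈ (suc i)) x∈))

    *-sum-∈⟨⟩ : ∀ {l m} → l ∈ K → (k v : Vector Carrier m) → (∀ i → k i ∈ K) →
                (∀ i → v i ∈ X) → l * sum (λ i → k i * v i) ∈ ⟨ X ⟩
    *-sum-∈⟨⟩ {m = 0}     l∈ k v k∈ v∈ = ⟨⟩-resp (sym (zeroʳ _)) ⟨⟩-0
    *-sum-∈⟨⟩ {m = suc m} l∈ k v k∈ v∈ =
      ⟨⟩-resp (sym (trans (distribˡ _ _ _) (+-congʳ (sym (*-assoc _ _ _)))))
        (⟨⟩-∷ (K.*-closed l∈ (k∈ zero)) (v∈ zero)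
          (*-sum-∈⟨⟩ l∈ (tail k) (tail v) (λ i → k∈ (suc i)) (λ i → v∈ (suc i))))

    ⊆⟨⟩ : X ⊆ ⟨ X ⟩
    ⊆⟨⟩ v∈ = ⟨⟩-resp (trans (+-identityʳ _) (*-identityˡ _)) (⟨⟩-∷ K.1∈ v∈ ⟨⟩-0)

  span : (Carrier → Set ℓ) → Subspace
  span X .Subspace.⟦_⟧ = ⟨ X ⟩
  span X .Subspace.isSubspace = record
    { resp     = ⟨⟩-resp {X}
    ; 0∈       = ⟨⟩-0 {X}
    ; +-closed = λ (m , k , v , k∈ , v∈ , eq) y∈ →
        ⟨⟩-resp {X} (+-congʳ (sym eq)) (sum-∈⟨⟩-+ {X} k v k∈ v∈ y∈)
    ; *-closed = λ l∈ (m , k , v , k∈ , v∈ , eq) →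
        ⟨⟩-resp {X} (*-congˡ (sym eq)) (*-sum-∈⟨⟩ {X} l∈ k v k∈ v∈)
    }

  sum-closed : ∀ V {n} (v : Vector Carrier n) → (∀ i → v i ∈ ⟦ V ⟧) → sum v ∈ ⟦ V ⟧
  sum-closed V {0}     v v∈ = Subspace.0∈ V
  sum-closed V {suc n} v v∈ =
    Subspace.+-closed V (v∈ zero) (sum-closed V (tail v) (λ i → v∈ (suc i)))

  span-least : ∀ {X V} → X ⊆ ⟦ V ⟧ → span X ⊑ V
  span-least {X} {V} X⊆V = incl λ (m , k , v , k∈ , v∈ , eq) → V.resp (sym eq)
    (sum-closed V _ (λ i → V.*-closed (k∈ i) (X⊆V (v∈ i))))
    where module V = Subspace V

  Span : ∀ {n} → Vector Carrier n → Subspace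
  Span v = span (range v)

  SpanExcept : ∀ {n} → Fin n → Vector Carrier n → Subspace
  SpanExcept i v = span (rangeExcept i v)

  Span-least : ∀ {V n} (v : Vector Carrier n) → (∀ i → v i ∈ ⟦ V ⟧) → Span v ⊑ V
  Span-least {V} v v∈ = span-least λ (i , eq) → Subspace.resp V (sym eq) (v∈ i)

  ∈-Span : ∀ {n} (v : Vector Carrier n) i → v i ∈ ⟦ Span v ⟧
  ∈-Span v i = ⊆⟨⟩ {range v} (i , refl)

  Span-tail : ∀ {n} (v : Vector Carrier (suc n)) → Span (tail v) ⊑ Span v
  Span-tail v = Span-least (tail v) λ i → ∈-Span v (suc i)

  Span-▹ : ∀ {n} (v : Vector Carrier (suc n)) → Span v ⊑ Span (tail v) ▹ v zero
  Span-▹ v = Span-least v λ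
    { zero    → ∈-▹ {Span (tail v)}
    ; (suc i) → app (⊑-▹ {Span (tail v)}) (∈-Span (tail v) i)
    }

  SpanExcept-least : ∀ {V n} i (v : Vector Carrier n) →
                     (∀ {j} → j ≢ i → v j ∈ ⟦ V ⟧) → SpanExcept i v ⊑ V
  SpanExcept-least {V} i v v∈ = span-least λ (j , j≢i , eq) → Subspace.resp V (sym eq) (v∈ j≢i)

  ∈-SpanExcept : ∀ {n i j} (v : Vector Carrier n) → j ≢ i → v j ∈ ⟦ SpanExcept i v ⟧
  ∈-SpanExcept {i = i} {j} v j≢i = ⊆⟨⟩ {rangeExcept i v} (j , j≢i , refl)

  SpanExcept-zero : ∀ {n} (v : Vector Carrier (suc n)) → SpanExcept zero v ⊑ Span (tail v)
  SpanExcept-zero v = SpanExcept-least zero v λ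
    { {zero}  0≢0 → contradiction ≡.refl 0≢0
    ; {suc j} _   → ∈-Span (tail v) j
    }

  SpanExcept-suc : ∀ {n} (v : Vector Carrier (suc n)) i →
                   SpanExcept (suc i) v ⊑ SpanExcept i (tail v) ▹ v zero
  SpanExcept-suc v i = SpanExcept-least (suc i) v λ
    { {zero}  _   → ∈-▹ {SpanExcept i (tail v)}
    ; {suc j} j≢i → app (⊑-▹ {SpanExcept i (tail v)})
        (∈-SpanExcept (tail v) λ j≡i → j≢i (≡.cong suc j≡i))
    }

  -- `⟨_⟩` admits combinations of any length with repeated vectors, whereas linear independence
  -- speaks of one coefficient per index. Peeling off `v zero` avoids regrouping the sum.
  Span⇒sum : ∀ {n} (v : Vector Carrier n) {x} → x ∈ ⟦ Span v ⟧ →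
             ∃ λ (k : Vector Carrier n) → (∀ i → k i ∈ K) × x ≈ sum (λ i → k i * v i)
  Span⇒sum {0} v x∈ =
    []ᶠ , (λ ()) , lower (app (Span-least {𝟎} v λ ()) x∈)
  Span⇒sum {suc n} v x∈ with app (Span-▹ v) x∈
  ... | y , k , y∈ , k∈ , eq with Span⇒sum (tail v) y∈
  ... | ks , ks∈ , eq′ =
    k ∷ᶠ ks , (λ { zero → k∈ ; (suc i) → ks∈ i }) ,
    trans eq (trans (+-congʳ eq′) (+-comm _ _))

  -- In x = v + ky the term ky = x - v lies in W, and y does not, so k vanishes.
  ∈-▹⇒∈ : ∀ {V W x y} → V ⊑ W → y ∉ ⟦ W ⟧ → x ∈ ⟦ V ▹ y ⟧ → x ∈ ⟦ W ⟧ → x ∈ ⟦ V ⟧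
  ∈-▹⇒∈ {V} {W} V⊑W y∉ (v , k , v∈ , k∈ , eq) x∈ = Subspace.resp V (sym (trans eq
    (trans (+-congˡ (trans (*-congʳ k≈0) (zeroˡ _))) (+-identityʳ v)))) v∈
    where
    module W = Subspace W
    k≈0 = W.coefficient≈0 k∈ (W.cancelˡ (app V⊑W v∈) (W.resp eq x∈)) y∉

  1≉0 : 1# ≉ 0#
  1≉0 1≈0 = 0≉1 (sym 1≈0)

  independent-tail : ∀ {n} (v : Vector Carrier (suc n)) →
                     LinearlyIndependent v → LinearlyIndependent (tail v)
  independent-tail v li k k∈ eq i = li (0# ∷ᶠ k)
    (λ { zero → K.0∈ ; (suc i) → k∈ i })
    (trans (+-cong (zeroˡ _) eq) (+-identityˡ 0#)) (suc i)

  independent-head : ∀ {n} (v : Vector Carrier (suc n)) →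
                     LinearlyIndependent v → v zero ∉ ⟦ Span (tail v) ⟧
  independent-head v li v₀∈ with Span⇒sum (tail v) v₀∈
  ... | k , k∈ , eq = 1≉0 (trans (sym (+-identityʳ 1#)) (trans (+-congˡ (sym -1≈0)) (-‿inverseʳ 1#)))
    where
    -1≈0 : - 1# ≈ 0#
    -1≈0 = li (- 1# ∷ᶠ k) (λ { zero → K.-‿closed K.1∈ ; (suc i) → k∈ i })
      (trans (+-cong (-1*x≈-x _) (sym eq)) (-‿inverseˡ _)) zero

  independent-≉0 : ∀ {n} (v : Vector Carrier n) → LinearlyIndependent v → ∀ i → v i ≉ 0#
  independent-≉0 v li zero    v₀≈0 = independent-head v li
    (Subspace.resp (Span (tail v)) (sym v₀≈0) (Subspace.0∈ (Span (tail v))))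
  independent-≉0 v li (suc i) = independent-≉0 (tail v) (independent-tail v li) i

  dim-Span : ∀ {n} (v : Vector Carrier n) → LinearlyIndependent v → Dim (Span v) n
  dim-Span {0}     v li = nil (𝟎⊑ (Span v)) (Span-least v λ ())
  dim-Span {suc n} v li = snoc (dim-Span (tail v) (independent-tail v li)) record
    { V⊑W = Span-tail v ; new∈ = ∈-Span v zero ; new∉ = independent-head v li ; cover = Span-▹ v }

  basis⇒dim : ∀ {V n} {v : Vector Carrier n} → IsBasis v ⟦ V ⟧ → Dim V n
  basis⇒dim {v = v} (li , p , q) = chain-respʳ (dim-Span v li) (incl p) (incl q)

  basis-[] : ∀ {V} {v : Vector Carrier 0} → V ⊑ 𝟎 → IsBasis v ⟦ V ⟧
  basis-[] {V} {v} V⊑𝟎 = (λ _ _ _ ()) ,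
    app (Span-least {V} v λ ()) , app (⊑-trans V⊑𝟎 (𝟎⊑ (Span v)))

  basis-∷ : ∀ {V W x n} {v : Vector Carrier n} → IsBasis v ⟦ V ⟧ →
            V ⊑ W → x ∈ ⟦ W ⟧ → x ∉ ⟦ V ⟧ → W ⊑ V ▹ x → IsBasis (x ∷ᶠ v) ⟦ W ⟧
  basis-∷ {V} {W} {x} {v = v} (li , p , q) V⊑W x∈ x∉ W⊑V▹x =
    independent ,
    app (Span-least {W} (x ∷ᶠ v) λ { zero → x∈ ; (suc i) → app V⊑W (p (∈-Span v i)) }) ,
    app (⊑-trans W⊑V▹x (▹-least (⊑-trans (incl {V} {Span v} q) (Span-tail (x ∷ᶠ v)))
                                (∈-Span (x ∷ᶠ v) zero)))
    where
    module V = Subspace V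
    independent : LinearlyIndependent (x ∷ᶠ v)
    independent k k∈ eq = λ { zero → k₀≈0 ; (suc i) → li (tail k) (λ i → k∈ (suc i))
      (trans (sym (+-identityˡ _)) (trans (+-congʳ (sym (trans (*-congʳ k₀≈0) (zeroˡ x)))) eq)) i }
      where
      k₀≈0 : k zero ≈ 0#
      k₀≈0 = V.coefficient≈0 (k∈ zero)
        (V.cancelʳ (sum-closed V _ λ i → V.*-closed (k∈ (suc i)) (p (∈-Span v i)))
          (V.resp (sym eq) V.0∈)) x∉

  -- J remembers which entries of the extended basis are the old ones; `unmatchable-pair` exploits
  -- that exactly these lie in a prescribed subspace.
  basis-extend : ∀ {V W m n} {v : Vector Carrier m} → Chain V W n → IsBasis v ⟦ V ⟧ →
    ∃₂ λ (w : Vector Carrier (n ℕ.+ m)) (J : FS.Subset (n ℕ.+ m)) →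
    IsBasis w ⟦ W ⟧ × FS.∣ J ∣ ≡ m × (∀ {i} → i FS.∈ J → w i ∈ ⟦ V ⟧)
  basis-extend {m = m} {v = v} (nil p q) (li , p′ , q′) =
    v , FS.⊤ , (li , (λ x∈ → app p (p′ x∈)) , (λ x∈ → q′ (app q x∈))) ,
    FSₚ.∣⊤∣≡n m , λ {i} _ → p′ (∈-Span v i)
  basis-extend {V} (snoc c s) b with basis-extend c b
  ... | w , J , b′ , eq , w∈ =
    new ∷ᶠ w , FS.outside ∷ J , basis-∷ b′ V⊑W new∈ new∉ cover , eq ,
    λ { {suc i} (there i∈) → w∈ i∈ }
    where open Step s

  dim⇒basis : ∀ {V n} → Dim V n → HasDim ⟦ V ⟧ n
  dim⇒basis {n = n} d with basis-extend d (basis-[] {v = []ᶠ} ⊑-refl)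
  ... | w , _ , b , _ = ≡.subst (HasDim _) (ℕₚ.+-identityʳ n) (w , b)

  -- Recursion on J makes the dimension visible: each element of J contributes one step of a chain.
  SpanOn : ∀ {n} → FS.Subset n → Vector Carrier n → Subspace
  SpanOn []                v = 𝟎
  SpanOn (FS.inside  ∷ J) v = SpanOn J (tail v) ▹ v zero
  SpanOn (FS.outside ∷ J) v = SpanOn J (tail v)

  SpanOn-least : ∀ {V n} (J : FS.Subset n) (v : Vector Carrier n) →
                 (∀ {i} → i FS.∈ J → v i ∈ ⟦ V ⟧) → SpanOn J v ⊑ V
  SpanOn-least {V} []           v v∈ = 𝟎⊑ V
  SpanOn-least (FS.inside  ∷ J) v v∈ =
    ▹-least (SpanOn-least J (tail v) λ i∈ → v∈ (there i∈)) (v∈ here)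
  SpanOn-least (FS.outside ∷ J) v v∈ = SpanOn-least J (tail v) λ i∈ → v∈ (there i∈)

  SpanOn⊑Span : ∀ {n} (J : FS.Subset n) (v : Vector Carrier n) → SpanOn J v ⊑ Span v
  SpanOn⊑Span J v = SpanOn-least J v λ {i} _ → ∈-Span v i

  dim-SpanOn : ∀ {n} (J : FS.Subset n) (v : Vector Carrier n) →
               LinearlyIndependent v → Dim (SpanOn J v) FS.∣ J ∣
  dim-SpanOn []               v li = nil ⊑-refl ⊑-refl
  dim-SpanOn (FS.inside  ∷ J) v li = snoc (dim-SpanOn J (tail v) (independent-tail v li))
    (step-▹ λ v₀∈ → independent-head v li (app (SpanOn⊑Span J (tail v)) v₀∈))
  dim-SpanOn (FS.outside ∷ J) v li = dim-SpanOn J (tail v) (independent-tail v li)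

  -- Membership in `SpanOn J v` kills the coordinates of x outside J, and the second condition kills
  -- those in J. Once x is known to lie in the span of the tail, `∈-▹⇒∈` removes `v zero` from every
  -- remaining condition.
  SpanOn-disjoint : ∀ {n x} (J : FS.Subset n) (v : Vector Carrier n) →
                    LinearlyIndependent v → x ∈ ⟦ SpanOn J v ⟧ →
                    (∀ {i} → i FS.∈ J → x ∈ ⟦ SpanExcept i v ⟧) → x ∈ ⟦ 𝟎 ⟧
  SpanOn-disjoint         []      v li x∈ _ = x∈
  SpanOn-disjoint {x = x} (s ∷ J) v li x∈ x∈v∖i =
    SpanOn-disjoint J (tail v) (independent-tail v li) x∈J λ {i} i∈ →
      ∈-▹⇒∈ {W = Span (tail v)} (SpanExcept-least i (tail v) λ {j} _ → ∈-Span (tail v) j)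
        (independent-head v li)
        (app (SpanExcept-suc v i) (x∈v∖i (there i∈))) (app (SpanOn⊑Span J (tail v)) x∈J)
    where
    x∈SpanOn : ∀ s → x ∈ ⟦ SpanOn (s ∷ J) v ⟧ →
               (∀ {i} → i FS.∈ s ∷ J → x ∈ ⟦ SpanExcept i v ⟧) → x ∈ ⟦ SpanOn J (tail v) ⟧
    x∈SpanOn FS.outside x∈ _     = x∈
    x∈SpanOn FS.inside  x∈ x∈v∖i = ∈-▹⇒∈ (SpanOn⊑Span J (tail v)) (independent-head v li) x∈
      (app (SpanExcept-zero v) (x∈v∖i here))
    x∈J = x∈SpanOn s x∈ x∈v∖i

  -- Rado's theorem

  ⋂ : ∀ {k} → FS.Subset k → (Fin k → Subspace) → Subspace
  ⋂ J V .Subspace.⟦_⟧ x = ∀ i → i FS.∈ J → x ∈ ⟦ V i ⟧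
  ⋂ J V .Subspace.isSubspace = record
    { resp     = λ x≈y x∈ i i∈ → Subspace.resp (V i) x≈y (x∈ i i∈)
    ; 0∈       = λ i _ → Subspace.0∈ (V i)
    ; +-closed = λ x∈ y∈ i i∈ → Subspace.+-closed (V i) (x∈ i i∈) (y∈ i i∈)
    ; *-closed = λ k∈ x∈ i i∈ → Subspace.*-closed (V i) k∈ (x∈ i i∈)
    }

  -- Rado's condition for the annihilators, expressed by intersections and without subtraction. The
  -- bound n stands apart from k and dim B: the induction step of `rado` uses n for a subspace X and
  -- n + 1 for B, over the same family. As `⋂` over the empty set is all of L, empty J bounds dim B
  -- itself.
  Hall : ∀ {k} → ℕ → Subspace → (Fin k → Subspace) → Set (Level.suc (c ⊔ ℓ))
  Hall {k} n B V = ∀ (J : FS.Subset k) {m} → Dim (B ∧ ⋂ J V) m → m ℕ.+ FS.∣ J ∣ ≤ n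

  hall-dim : ∀ {k n p X} {V : Fin k → Subspace} → Hall n X V → Dim X p → p ≤ n
  hall-dim {k} hall d = ℕₚ.m+n≤o⇒m≤o _ (hall FS.⊥
    (chain-respʳ d (∧-greatest ⊑-refl (incl λ _ i i∈ → contradiction i∈ FSₚ.∉⊥)) ∧-⊑ˡ))

  ∣∪∣+∣∩∣ : ∀ {k} (I J : FS.Subset k) →
            FS.∣ I FS.∪ J ∣ ℕ.+ FS.∣ I FS.∩ J ∣ ≡ FS.∣ I ∣ ℕ.+ FS.∣ J ∣
  ∣∪∣+∣∩∣ [] [] = ≡.refl
  ∣∪∣+∣∩∣ (FS.outside ∷ I) (FS.outside ∷ J) = ∣∪∣+∣∩∣ I J
  ∣∪∣+∣∩∣ (FS.inside  ∷ I) (FS.outside ∷ J) = ≡.cong suc (∣∪∣+∣∩∣ I J)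
  ∣∪∣+∣∩∣ (FS.outside ∷ I) (FS.inside  ∷ J) =
    ≡.trans (≡.cong suc (∣∪∣+∣∩∣ I J)) (≡.sym (ℕₚ.+-suc _ _))
  ∣∪∣+∣∩∣ (FS.inside  ∷ I) (FS.inside  ∷ J) = ≡.cong suc (≡.trans (ℕₚ.+-suc _ _)
    (≡.trans (≡.cong suc (∣∪∣+∣∩∣ I J)) (≡.sym (ℕₚ.+-suc _ _))))

  -- The modular law with room on both sides; containment in T makes Y and Z finite-dimensional.
  submodular : ∀ {P Q Y Z T p q t} → P ∧ Q ⊑ Y → P ∨ Q ⊑ Z → Y ⊑ T → Z ⊑ T →
               Dim T t → Dim P p → Dim Q q →
               ∃₂ λ y z → Dim Y y × Dim Z z × p ℕ.+ q ≤ y ℕ.+ z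
  submodular P∧Q⊑Y P∨Q⊑Z Y⊑T Z⊑T dT dP dQ
    with dim-⊑ Y⊑T dT | dim-⊑ Z⊑T dT
  ... | y , dY , _ | z , dZ , _ with dim-⊑ P∧Q⊑Y dY | dim-⊑ P∨Q⊑Z dZ
  ... | s , d∧ , s≤y | t , d∨ , t≤z = y , z , dY , dZ ,
    ℕₚ.≤-trans (ℕₚ.≤-reflexive (modular dP dQ d∧ d∨)) (ℕₚ.+-mono-≤ s≤y t≤z)

  -- If both enlargements violated the condition, at I and at J say, then by
  -- submodularity it would already fail for X at I ∪ J or for B at I ∩ J.
  hall-one-of-two : ∀ {k n X X₁ X₂ B b} {V : Fin k → Subspace} →
    X₁ ⊑ B → X₂ ⊑ B → X₁ ∧ X₂ ⊑ X → X ⊑ B → Dim B b →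
    Hall n X V → Hall (suc n) B V → ¬ Hall n X₁ V → Hall n X₂ V
  hall-one-of-two {n = n} {X} {X₁} {X₂} {B} {V = V}
    X₁⊑B X₂⊑B X₁∧X₂⊑X X⊑B dB hallX hallB ¬hall₁ J {q} dQ =
    ℕₚ.≮⇒≥ λ bad₂ → contradiction (λ I {p} dP → ℕₚ.≮⇒≥ λ bad₁ → violate I dP bad₁ bad₂) ¬hall₁
    where
    violate : ∀ I {p} → Dim (X₁ ∧ ⋂ I V) p → n < p ℕ.+ FS.∣ I ∣ → ¬ (n < q ℕ.+ FS.∣ J ∣)
    violate I {p} dP bad₁ bad₂
      with submodular {Y = X ∧ ⋂ (I FS.∪ J) V} {B ∧ ⋂ (I FS.∩ J) V}
        (incl λ ((x∈X₁ , x∈I) , (x∈X₂ , x∈J)) → app X₁∧X₂⊑X (x∈X₁ , x∈X₂) ,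
          λ i i∈ → [ x∈I i , x∈J i ] (FSₚ.x∈p∪q⁻ I J i∈))
        (∨-least
          (incl λ (x∈X₁ , x∈I) → app X₁⊑B x∈X₁ , λ i i∈ → x∈I i (proj₁ (FSₚ.x∈p∩q⁻ I J i∈)))
          (incl λ (x∈X₂ , x∈J) → app X₂⊑B x∈X₂ , λ i i∈ → x∈J i (proj₂ (FSₚ.x∈p∩q⁻ I J i∈))))
        (⊑-trans ∧-⊑ˡ X⊑B) ∧-⊑ˡ dB dP dQ
    -- The two violations add up to at least 2n + 2, while `hallX` and `hallB` together allow n + (n
    -- + 1).
    ... | y , z , dY , dZ , p+q≤y+z = ℕₚ.n≮n (n ℕ.+ suc n) (begin-strict
      n ℕ.+ suc n <⟨ ℕₚ.≤-refl ⟩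
      suc n ℕ.+ suc n ≤⟨ ℕₚ.+-mono-≤ bad₁ bad₂ ⟩
      (p ℕ.+ FS.∣ I ∣) ℕ.+ (q ℕ.+ FS.∣ J ∣) ≡⟨ +-interchange p _ q _ ⟩
      (p ℕ.+ q) ℕ.+ (FS.∣ I ∣ ℕ.+ FS.∣ J ∣)
        ≤⟨ ℕₚ.+-mono-≤ p+q≤y+z (ℕₚ.≤-reflexive (≡.sym (∣∪∣+∣∩∣ I J))) ⟩
      (y ℕ.+ z) ℕ.+ (FS.∣ I FS.∪ J ∣ ℕ.+ FS.∣ I FS.∩ J ∣) ≡⟨ +-interchange y z _ _ ⟩
      (y ℕ.+ FS.∣ I FS.∪ J ∣) ℕ.+ (z ℕ.+ FS.∣ I FS.∩ J ∣)
        ≤⟨ ℕₚ.+-mono-≤ (hallX (I FS.∪ J) dY) (hallB (I FS.∩ J) dZ) ⟩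
      n ℕ.+ suc n ∎)
      where
      open ℕₚ.≤-Reasoning
      open import Algebra.Properties.CommutativeSemigroup ℕₚ.+-commutativeSemigroup using ()
        renaming (interchange to +-interchange)

  ⊏-witness : ∀ {V W m n} → Dim V m → Dim W n → m < n → ∃ λ x → x ∈ ⟦ W ⟧ × x ∉ ⟦ V ⟧
  ⊏-witness dV dW m<n = ¬⊑⇒∃ λ W⊑V → ℕₚ.<⇒≱ m<n (dim-≤ W⊑V dW dV)

  -- As p + 2 ≤ dim B, there are two directions x and y independent modulo X. The spaces X ▹ x and X
  -- ▹ y meet in X, so one of them inherits the condition.
  hall-enlarge : ∀ {k n p X B} {V : Fin k → Subspace} → X ⊑ B → Dim X p → Dim B (suc n) →
    p < n → Hall n X V → Hall (suc n) B V →
    ∃ λ Y → X ⊑ Y × Y ⊑ B × Dim Y (suc p) × Hall n Y V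
  hall-enlarge {n = n} {X = X} {V = V} X⊑B dX dB p<n hallX hallB with ⊏-witness dX dB (ℕₚ.m<n⇒m<1+n p<n)
  ... | x , x∈B , x∉X with ⊏-witness (snoc dX (step-▹ x∉X)) dB (s≤s p<n)
  ... | y , y∈B , y∉X▹x with em {P = Hall n (X ▹ x) V}
  ... | yes hall = X ▹ x , ⊑-▹ , ▹-least X⊑B x∈B , snoc dX (step-▹ x∉X) , hall
  ... | no ¬hall = X ▹ y , ⊑-▹ , ▹-least X⊑B y∈B ,
    snoc dX (step-▹ λ y∈X → y∉X▹x (app (⊑-▹ {X}) y∈X)) ,
    hall-one-of-two (▹-least X⊑B x∈B) (▹-least X⊑B y∈B)
      (incl λ (z∈X▹x , z∈X▹y) → ∈-▹⇒∈ {X} ⊑-▹ y∉X▹x z∈X▹y z∈X▹x) X⊑B dB hallX hallB ¬hall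

  -- In `rado`, X is B ∧ V zero, and H becomes the kernel of the functional dual to the first basis
  -- vector.
  hall-hyperplane : ∀ {k n p X B} {V : Fin k → Subspace} (j : ℕ) → j ℕ.+ p ≡ n →
    X ⊑ B → Dim X p → Dim B (suc n) → Hall n X V → Hall (suc n) B V →
    ∃ λ H → X ⊑ H × H ⊑ B × Dim H n × Hall n H V
  hall-hyperplane {X = X} 0 ≡.refl X⊑B dX dB hallX hallB = X , ⊑-refl , X⊑B , dX , hallX
  hall-hyperplane {p = p} (suc j) ≡.refl X⊑B dX dB hallX hallB
    with hall-enlarge X⊑B dX dB (s≤s (ℕₚ.m≤n+m p j)) hallX hallB
  ... | Y , X⊑Y , Y⊑B , dY , hallY
    with hall-hyperplane j (ℕₚ.+-suc j p) Y⊑B dY dB hallY hallB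
  ... | H , Y⊑H , H⊑B , dH , hallH = H , ⊑-trans X⊑Y Y⊑H , H⊑B , dH , hallH

  Span⊑SpanExcept-▹ : ∀ {n} (v : Vector Carrier n) i → Span v ⊑ SpanExcept i v ▹ v i
  Span⊑SpanExcept-▹ v i = Span-least v v∈
    where
    v∈ : ∀ j → v j ∈ ⟦ SpanExcept i v ▹ v i ⟧
    v∈ j with j Fin.≟ i
    ... | yes ≡.refl = ∈-▹ {SpanExcept i v}
    ... | no  j≢i    = app (⊑-▹ {SpanExcept i v}) (∈-SpanExcept v j≢i)

  sum-split : ∀ V {n} (t : Vector Carrier n) i → (∀ {j} → j ≢ i → t j ∈ ⟦ V ⟧) →
              ∃ λ x → x ∈ ⟦ V ⟧ × sum t ≈ t i + x
  sum-split V {suc n} t i t∈ =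
    sum (removeAt t i) , sum-closed V _ (λ j → t∈ (punchInᵢ≢i i j)) , sum-remove t

  -- With H a hyperplane containing V₀ and b a basis of H for the remaining
  -- subspaces, b is completed by a vector y + Σ cᵢ bᵢ: the condition at i
  -- restricts only the coefficient cᵢ.
  rado-coefficient : ∀ {n H B V y} {b : Vector Carrier n} → IsBasis b ⟦ H ⟧ → Step H B →
    y ∈ ⟦ B ⟧ → y ∉ ⟦ H ⟧ → ∀ i → H ∧ V ⊑ SpanExcept i b →
    ∃ λ k → k ∈ K × (∀ {X} → SpanExcept i b ⊑ X → y + k * b i ∈ ⟦ X ⟧ → B ∧ V ⊑ X)
  rado-coefficient {H = H} {B} {V} {y} {b} (_ , _ , H⊆) s y∈B y∉H i H∧V⊑ with em {P = B ∧ V ⊑ H}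
  -- Here B ∧ V already lies in H, so the coefficient is unconstrained and 0 is a default.
  ... | yes B∧V⊑H = 0# , K.0∈ , λ b⊑X _ →
    ⊑-trans (∧-greatest B∧V⊑H ∧-⊑ʳ) (⊑-trans H∧V⊑ b⊑X)
  ... | no  B∧V⋢H with ¬⊑⇒∃ B∧V⋢H
  ... | z , (z∈B , z∈V) , z∉H with app (exchange s y∈B y∉H) z∈B
  ... | h , l , h∈ , l∈ , z≈ with em {P = l ≈ 0#}
  ... | yes l≈0 = contradiction (Subspace.resp H (sym (trans z≈ (trans (+-congˡ
          (trans (*-congʳ l≈0) (zeroˡ y))) (+-identityʳ h)))) h∈) z∉H
  ... | no  l≉0 with app (Span⊑SpanExcept-▹ b i) (H⊆ (Subspace.*-closed H (K.⁻¹-closed l∈ l≉0) h∈))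
  -- Up to the factor l, z is y + h / l, and k is the coordinate of h / l at `b i`; hence z ∈ X once
  -- y + k `b i` is. As B ∧ V is H ∧ V plus the line of z, this suffices. X stays open because it
  -- will depend on all the coefficients at once.
  ... | g , k , g∈ , k∈ , h/l≈ = k , k∈ , λ {X} b⊑X y+∈ →
    let module X = Subspace X
        y+h/l∈ : y + l ⁻¹ * h ∈ ⟦ X ⟧
        y+h/l∈ = X.resp (trans (+-assoc y _ g) (+-congˡ (trans (+-comm _ g) (sym h/l≈))))
                   (X.+-closed y+∈ (app b⊑X g∈))
        z∈X : z ∈ ⟦ X ⟧
        z∈X = X.resp (trans (distribˡ l y _) (trans (+-congˡ (*-⁻¹-cancelˡ h l≉0))
                (trans (+-comm _ h) (sym z≈)))) (X.*-closed l∈ y+h/l∈)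
    in incl λ (w∈B , w∈V) →
      let (h′ , l′ , h′∈ , l′∈ , w≈) = app (exchange s z∈B z∉H) w∈B
          h′∈V = Subspace.cancelʳ V (Subspace.*-closed V l′∈ z∈V) (Subspace.resp V w≈ w∈V)
      in X.resp (sym w≈) (X.+-closed (app b⊑X (app H∧V⊑ (h′∈ , h′∈V))) (X.*-closed l′∈ z∈X))

  -- Setting the first subspace aside splits the condition: index sets containing zero bound B ∧ V
  -- zero by n, the others bound B by n + 1. These are the two inputs of `hall-hyperplane`, whose
  -- hyperplane H carries the induction; a vector outside H is then corrected for all remaining
  -- subspaces simultaneously.
  rado : ∀ n {B} → Dim B n → (V : Fin n → Subspace) → Hall n B V →
         ∃ λ (b : Vector Carrier n) → IsBasis b ⟦ B ⟧ × (∀ i → B ∧ V i ⊑ SpanExcept i b)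
  rado 0 (nil _ B⊑𝟎) V hall = []ᶠ , basis-[] B⊑𝟎 , λ ()
  rado (suc n) {B} dB V hall with dim-⊑ (∧-⊑ˡ {B} {V zero}) dB
  ... | p , dX , _ with hall-hyperplane (n ℕ.∸ p) (ℕₚ.m∸n+n≡m (hall-dim hallX dX)) ∧-⊑ˡ dX dB hallX hallB
    where
    hallX : Hall n (B ∧ V zero) (λ i → V (suc i))
    hallX J {m} d = ℕ.s≤s⁻¹ (≡.subst (_≤ suc n) (ℕₚ.+-suc m _) (hall (FS.inside ∷ J)
      (chain-respʳ d
        (incl λ ((x∈B , x∈V₀) , x∈J) → x∈B , λ { zero here → x∈V₀ ; (suc i) (there i∈) → x∈J i i∈ })
        (incl λ (x∈B , x∈J) → (x∈B , x∈J zero here) , λ i i∈ → x∈J (suc i) (there i∈)))))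
    hallB : Hall (suc n) B (λ i → V (suc i))
    hallB J d = hall (FS.outside ∷ J) (chain-respʳ d
      (incl λ (x∈B , x∈J) → x∈B , λ { (suc i) (there i∈) → x∈J i i∈ })
      (incl λ (x∈B , x∈J) → x∈B , λ i i∈ → x∈J (suc i) (there i∈)))
  ... | H , X⊑H , H⊑B , dH , hallH with rado n dH (λ i → V (suc i)) hallH | codim H⊑B dH dB
  ... | b , basis@(_ , ⊆H , H⊆) , H∧V⊑ | j , c , j+n≡1+n with ℕₚ.+-cancelʳ-≡ n j 1 j+n≡1+n
  ... | ≡.refl = b₀ ∷ᶠ b , basis-∷ basis H⊑B b₀∈B b₀∉H (exchange s b₀∈B b₀∉H) , λ
    { zero    → ⊑-trans X⊑H (incl λ x∈ → app (Span-least {SpanExcept zero (b₀ ∷ᶠ b)} b λ i →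
                  ∈-SpanExcept {j = suc i} (b₀ ∷ᶠ b) λ ()) (H⊆ x∈))
    ; (suc i) → proj₂ (proj₂ (coefficient i)) (b⊑ i) (y+∈ i)
    }
    where
    s : Step H B
    s = chain-one c
    open Step s using () renaming (new to y; new∈ to y∈B; new∉ to y∉H)
    coefficient : ∀ i → _
    coefficient i = rado-coefficient {V = V (suc i)} basis s y∈B y∉H i (H∧V⊑ i)
    k : Vector Carrier n
    k i = proj₁ (coefficient i)
    k∈ : ∀ i → k i ∈ K
    k∈ i = proj₁ (proj₂ (coefficient i))
    kb : Vector Carrier n
    kb i = k i * b i
    kb∈H : sum kb ∈ ⟦ H ⟧
    kb∈H = sum-closed H kb λ i → Subspace.*-closed H (k∈ i) (⊆H (∈-Span b i))
    b₀ : Carrier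
    b₀ = y + sum kb
    b₀∈B : b₀ ∈ ⟦ B ⟧
    b₀∈B = Subspace.+-closed B y∈B (app H⊑B kb∈H)
    b₀∉H : b₀ ∉ ⟦ H ⟧
    b₀∉H b₀∈H = y∉H (Subspace.cancelʳ H kb∈H b₀∈H)
    b⊑ : ∀ i → SpanExcept i b ⊑ SpanExcept (suc i) (b₀ ∷ᶠ b)
    b⊑ i = SpanExcept-least i b λ {j} j≢i →
      ∈-SpanExcept {j = suc j} (b₀ ∷ᶠ b) λ eq → j≢i (suc-injective eq)
    y+∈ : ∀ i → y + kb i ∈ ⟦ SpanExcept (suc i) (b₀ ∷ᶠ b) ⟧
    y+∈ i with sum-split (SpanExcept i b) kb i
      (λ {j} j≢i → Subspace.*-closed (SpanExcept i b) (k∈ j) (∈-SpanExcept b j≢i))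
    -- y + `kb i` is b₀ minus the terms `kb j` with j ≠ i, and none of these involves `b i`.
    ... | g , g∈ , kb≈ = X.cancelʳ (app (b⊑ i) g∈)
      (X.resp (trans (+-congˡ kb≈) (sym (+-assoc y _ g))) (∈-SpanExcept {j = zero} (b₀ ∷ᶠ b) λ ()))
      where module X = Subspace (SpanExcept (suc i) (b₀ ∷ᶠ b))

  -- Subfields and their vector spaces

  Stable : Subset → Subspace → Set (c ⊔ ℓ)
  Stable F S = ∀ {f x} → f ∈ F → x ∈ ⟦ S ⟧ → f * x ∈ ⟦ S ⟧

  ⁻¹-≉0 : ∀ {x} → x ≉ 0# → x ⁻¹ ≉ 0#
  ⁻¹-≉0 {x} x≉0 x⁻¹≈0 = 1≉0 (trans (sym (⁻¹-inverseˡ x x≉0)) (trans (*-congʳ x⁻¹≈0) (zeroˡ x)))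

  module _ {F : Subspace} (isSubfieldF : IsSubfield ⟦ F ⟧) {d} (dF : Dim F d) where
    private module F = IsSubfield isSubfieldF

    degree>0 : 0 < d
    degree>0 = ℕₚ.n≢0⇒n>0 λ d≡0 → 1≉0 (lower (F⊑𝟎 d≡0 dF))
      where
      F⊑𝟎 : ∀ {d} → d ≡ 0 → Dim F d → 1# ∈ ⟦ 𝟎 ⟧
      F⊑𝟎 ≡.refl (nil _ p) = app p F.1∈

    -- The line xF meets S trivially, since xf ∈ S with f ≉ 0 would give x ∈ S; so adjoining it adds
    -- exactly d dimensions.
    stable-∨ : ∀ {S T x m} → Stable ⟦ F ⟧ S → Stable ⟦ F ⟧ T → S ⊑ T → Dim S m →
               x ∈ ⟦ T ⟧ → x ∉ ⟦ S ⟧ →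
               ∃ λ S′ → Stable ⟦ F ⟧ S′ × S′ ⊑ T × Dim S′ (m ℕ.+ d)
    stable-∨ {S} {T} {x} FS⊆S FT⊆T S⊑T dS x∈T x∉S =
      S ∨ xF , stable , ∨-least S⊑T xF⊑T , dim-∨ dS (dim-÷ (⁻¹-≉0 x≉0) dF) S∧xF⊑𝟎
      where
      module S = Subspace S
      x≉0 : x ≉ 0#
      x≉0 x≈0 = x∉S (S.resp (sym x≈0) S.0∈)
      xF : Subspace
      xF = F ÷ x ⁻¹
      stable : Stable ⟦ F ⟧ (S ∨ xF)
      stable f∈ (s , y , s∈ , y∈ , eq) =
        _ , _ , FS⊆S f∈ s∈ ,
        F.resp (x∙yz≈y∙xz _ _ y) (F.*-closed f∈ y∈) , trans (*-congˡ eq) (distribˡ _ s y)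
      xF⊑T : xF ⊑ T
      xF⊑T = incl λ {y} y∈ → Subspace.resp T
        (trans (*-comm _ x) (*-⁻¹-cancelˡ y x≉0)) (FT⊆T y∈ x∈T)
      S∧xF⊑𝟎 : S ∧ xF ⊑ 𝟎
      S∧xF⊑𝟎 = incl λ {y} (y∈S , f∈) → lift (y≈0 y y∈S f∈)
        where
        y≈0 : ∀ y → y ∈ ⟦ S ⟧ → x ⁻¹ * y ∈ ⟦ F ⟧ → y ≈ 0#
        y≈0 y y∈S f∈ with em {P = x ⁻¹ * y ≈ 0#}
        ... | yes f≈0 = trans (sym (*-⁻¹-cancelˡ y x≉0)) (trans (*-congˡ f≈0) (zeroʳ x))
        ... | no  f≉0 = contradiction (S.resp
          (trans (*-congˡ (trans (sym (*-⁻¹-cancelˡ y x≉0)) (*-comm x _))) (⁻¹-*-cancelˡ x f≉0))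
          (FS⊆S (F.⁻¹-closed f∈ f≉0) y∈S)) x∉S

    -- Adjoins F-lines until T is exhausted or q of them are found. With q beyond dim T only
    -- exhaustion remains, which gives d ∣ dim T; for T = 𝕌 exhaustion contradicts n < [L:K], which
    -- gives the F-space of the construction.
    stable-multiple : ∀ {T} → Stable ⟦ F ⟧ T → ∀ q →
      (∃ λ j → j < q × Dim T (j ℕ.* d)) ⊎
      (∃ λ S → Stable ⟦ F ⟧ S × S ⊑ T × Dim S (q ℕ.* d))
    stable-multiple {T} FT⊆T 0 = inj₂ (𝟎 ,
      (λ _ (lift x≈0) → lift (trans (*-congˡ x≈0) (zeroʳ _))) , 𝟎⊑ T , nil ⊑-refl ⊑-refl)
    stable-multiple {T} FT⊆T (suc q) with stable-multiple FT⊆T q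
    ... | inj₁ (j , j<q , dT) = inj₁ (j , ℕₚ.m<n⇒m<1+n j<q , dT)
    ... | inj₂ (S , FS⊆S , S⊑T , dS) with em {P = T ⊑ S}
    ... | yes T⊑S = inj₁ (q , ℕₚ.≤-refl , chain-respʳ dS S⊑T T⊑S)
    ... | no  T⋢S with ¬⊑⇒∃ T⋢S
    ... | x , x∈T , x∉S with stable-∨ FS⊆S FT⊆T S⊑T dS x∈T x∉S
    ... | S′ , FS′⊆S′ , S′⊑T , dS′ =
      inj₂ (S′ , FS′⊆S′ , S′⊑T , ≡.subst (Dim S′) (ℕₚ.+-comm (q ℕ.* d) d) dS′)

    degree-∣ : ∀ {T t} → Stable ⟦ F ⟧ T → Dim T t → d ∣ t
    degree-∣ {T} {t} FT⊆T dT with stable-multiple FT⊆T (suc t)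
    ... | inj₁ (j , _ , dT′) = divides j (chain-unique dT dT′)
    ... | inj₂ (S , _ , S⊑T , dS) = contradiction
      (ℕₚ.≤-trans (ℕₚ.m≤m*n (suc t) d {{ℕ.>-nonZero degree>0}}) (dim-≤ S⊑T dS dT)) (ℕₚ.n≮n t)

  stabilizer : Subspace → Subspace
  stabilizer S .Subspace.⟦_⟧ x = ∀ y → y ∈ ⟦ S ⟧ → x * y ∈ ⟦ S ⟧
  stabilizer S .Subspace.isSubspace = record
    { resp     = λ x≈x′ p y y∈ → S.resp (*-congʳ x≈x′) (p y y∈)
    ; 0∈       = λ y y∈ → S.resp (sym (zeroˡ y)) S.0∈
    ; +-closed = λ p q y y∈ → S.resp (sym (distribʳ y _ _)) (S.+-closed (p y y∈) (q y y∈))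
    ; *-closed = λ k∈ p y y∈ → S.resp (sym (*-assoc _ _ y)) (S.*-closed k∈ (p y y∈))
    }
    where module S = Subspace S

  -- Finite dimension provides the inverses: for x ≉ 0 the inclusion S ⊑ S ÷ x relates spaces of
  -- equal dimension, hence is an equality.
  stabilizer-isSubfield : ∀ {S n} → Dim S n → IsSubfield ⟦ stabilizer S ⟧
  stabilizer-isSubfield {S} dS = record
    { resp      = Stab.resp
    ; 0∈        = Stab.0∈
    ; 1∈        = λ y y∈ → S.resp (sym (*-identityˡ y)) y∈
    ; +-closed  = Stab.+-closed
    ; -‿closed  = λ {x} p → Stab.resp (-1*x≈-x x) (Stab.*-closed (K.-‿closed K.1∈) p)
    ; *-closed  = λ p q y y∈ → S.resp (sym (*-assoc _ _ y)) (p _ (q y y∈))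
    ; ⁻¹-closed = λ p x≉0 y y∈ → app (dim-≡ (incl λ {y} y∈ → p y y∈) dS (dim-÷ x≉0 dS))
        (S.resp (sym (*-⁻¹-cancelˡ y x≉0)) y∈)
    }
    where
    module S = Subspace S
    module Stab = Subspace (stabilizer S)

  -- The e-transform and a field of indivisible degree

  K-space : Subspace
  K-space = 𝟎 ▹ 1#

  K⊆⇒K-space⊑ : ∀ {V} → K ⊆ ⟦ V ⟧ → K-space ⊑ V
  K⊆⇒K-space⊑ {V} K⊆V = ▹-least (𝟎⊑ V) (K⊆V K.1∈)

  ⊆K⇒⊑K-space : ∀ {V} → ⟦ V ⟧ ⊆ K → V ⊑ K-space
  ⊆K⇒⊑K-space V⊆K = incl λ {x} x∈ →
    0# , x , lift refl , V⊆K x∈ , sym (trans (+-identityˡ _) (*-identityʳ x))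

  dim-K-space : Dim K-space 1
  dim-K-space = snoc (nil ⊑-refl ⊑-refl) (step-▹ λ (lift 1≈0) → 1≉0 1≈0)

  -- Dyson's e-transform (A₀ , B₁) ↦ (A₀ + eB₁ , B₁ ∩ e⁻¹A₀) preserves the sum
  -- of the dimensions and keeps the product inside A; it shrinks B₁ for some
  -- e ∈ A₀ unless A₀B₁ ⊆ A₀.
  e-transform : ∀ fuel {A A₀ B₁ n p m} → m < fuel →
    Dim A n → Dim A₀ p → Dim B₁ m → 0 < p → 1# ∈ ⟦ B₁ ⟧ →
    (∀ {x y} → x ∈ ⟦ A₀ ⟧ → y ∈ ⟦ B₁ ⟧ → x * y ∈ ⟦ A ⟧) →
    ∃₂ λ S B′ → ∃₂ λ s m′ → Dim S s × Dim B′ m′ × 0 < s × S ⊑ A × s ℕ.+ m′ ≡ p ℕ.+ m ×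
      (∀ {x y} → x ∈ ⟦ S ⟧ → y ∈ ⟦ B′ ⟧ → x * y ∈ ⟦ S ⟧)
  e-transform (suc fuel) {A} {A₀} {B₁} {n} {p} {m} (s≤s m≤fuel) dA dA₀ dB₁ 0<p 1∈B₁ A₀B₁⊆A
    with em {P = ∃ λ e → e ∈ ⟦ A₀ ⟧ × ¬ (B₁ ⊑ A₀ ÷ e)}
  ... | no closed = A₀ , B₁ , p , m , dA₀ , dB₁ , 0<p ,
    incl (λ {x} x∈ → Subspace.resp A (*-identityʳ x) (A₀B₁⊆A x∈ 1∈B₁)) , ≡.refl , A₀B₁⊆A₀
    where
    A₀B₁⊆A₀ : ∀ {x y} → x ∈ ⟦ A₀ ⟧ → y ∈ ⟦ B₁ ⟧ → x * y ∈ ⟦ A₀ ⟧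
    A₀B₁⊆A₀ {x} x∈ y∈ with em {P = B₁ ⊑ A₀ ÷ x}
    ... | yes xB₁⊑A₀ = app xB₁⊑A₀ y∈
    ... | no  xB₁⋢A₀ = contradiction (x , x∈ , xB₁⋢A₀) closed
  ... | yes (e , e∈ , eB₁⋢A₀) =
    let (m′ , dB′ , m′≤m) = dim-⊑ (∧-⊑ˡ {B₁} {A₀ ÷ e}) dB₁
        (p′ , dA′ , _)    = dim-⊑ A′⊑A dA
        m′<m = ℕₚ.≤∧≢⇒< m′≤m λ m′≡m →
          eB₁⋢A₀ (⊑-trans (dim-≡ ∧-⊑ˡ (≡.subst (Dim B′) m′≡m dB′) dB₁) ∧-⊑ʳ)
        -- Scaled by e, B′ becomes A₀ ∧ eB₁, the meet that belongs to the join A′ in the modular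
        -- law.
        p+m≡m′+p′ = modular dA₀ (dim-÷ e⁻¹≉0 dB₁)
          (chain-respʳ (dim-÷ e⁻¹≉0 dB′)
            (incl λ {y} (y/e∈ , y∈) → A₀.resp (*-⁻¹-cancelˡ y e≉0) y∈ , y/e∈)
            (incl λ {y} (y∈ , y/e∈) → y/e∈ , A₀.resp (sym (*-⁻¹-cancelˡ y e≉0)) y∈))
          dA′
        (S , B″ , s , m″ , dS , dB″ , 0<s , S⊑A , s+m″≡ , SB″⊆S) = e-transform fuel
          (ℕₚ.<-≤-trans m′<m m≤fuel) dA dA′ dB′ (ℕₚ.<-≤-trans 0<p (dim-≤ ⊑-∨ˡ dA₀ dA′))
          (1∈B₁ , A₀.resp (sym (*-identityʳ e)) e∈) A′B′⊆A
    in S , B″ , s , m″ , dS , dB″ , 0<s , S⊑A ,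
       ≡.trans s+m″≡ (≡.trans (ℕₚ.+-comm p′ m′) (≡.sym p+m≡m′+p′)) , SB″⊆S
    where
    module A  = Subspace A
    module A₀ = Subspace A₀
    e≉0 : e ≉ 0#
    e≉0 e≈0 = eB₁⋢A₀ (incl λ {y} _ →
      A₀.resp (sym (trans (*-congʳ e≈0) (zeroˡ y))) A₀.0∈)
    e⁻¹≉0 : e ⁻¹ ≉ 0#
    e⁻¹≉0 = ⁻¹-≉0 e≉0
    A′ B′ : Subspace
    A′ = A₀ ∨ B₁ ÷ e ⁻¹
    B′ = B₁ ∧ A₀ ÷ e
    A′⊑A : A′ ⊑ A
    A′⊑A = ∨-least (incl λ {x} x∈ → A.resp (*-identityʳ x) (A₀B₁⊆A x∈ 1∈B₁))
      (incl λ {y} y/e∈ → A.resp (*-⁻¹-cancelˡ y e≉0) (A₀B₁⊆A e∈ y/e∈))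
    A′B′⊆A : ∀ {x y} → x ∈ ⟦ A′ ⟧ → y ∈ ⟦ B′ ⟧ → x * y ∈ ⟦ A ⟧
    A′B′⊆A {y = y} (a , w , a∈ , w/e∈ , x≈) (y∈ , ey∈) =
      A.resp (sym (trans (*-congʳ x≈) (distribʳ y a w)))
        (A.+-closed (A₀B₁⊆A a∈ y∈) (A.resp ey*w/e≈wy (A₀B₁⊆A ey∈ w/e∈)))
      where
      -- In the cross term e moves from one factor to the other: ey lies in A₀ and w / e in B₁.
      ey*w/e≈wy : (e * y) * (e ⁻¹ * w) ≈ w * y
      ey*w/e≈wy = trans (*-assoc e y _) (trans (*-congˡ (x∙yz≈y∙xz y _ w))
        (trans (*-⁻¹-cancelˡ _ e≉0) (*-comm y w)))

  HasIndivisibleDegree : ℕ → Set (Level.suc (c ⊔ ℓ))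
  HasIndivisibleDegree n = ∃₂ λ F d → IsProperExtensionOfDegree F d × d ≤ n × d ∤ suc n

  -- n + 1 lies strictly between the consecutive multiples s and s + d.
  no-next-multiple : ∀ {d s n} → d ∣ s → s ≤ n → suc (suc n) ≤ s ℕ.+ d → d ∤ suc n
  no-next-multiple {d} {s} {n} (divides j ≡.refl) s≤n 2+n≤s+d (divides k 1+n≡kd) =
    ℕₚ.n≮n (suc n) (begin
      suc (suc n)      ≤⟨ 2+n≤s+d ⟩
      j ℕ.* d ℕ.+ d    ≡⟨ ℕₚ.+-comm (j ℕ.* d) d ⟩
      suc j ℕ.* d      ≤⟨ ℕₚ.*-monoˡ-≤ d (ℕₚ.*-cancelʳ-< d j k
                            (≡.subst (j ℕ.* d <_) 1+n≡kd (s≤s s≤n))) ⟩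
      k ℕ.* d          ≡⟨ 1+n≡kd ⟨
      suc n            ∎)
    where open ℕₚ.≤-Reasoning

  hall-violation⇒indivisible : ∀ {A B n m} {a : Vector Carrier n} → IsBasis a ⟦ A ⟧ →
    Dim B n → 1# ∉ ⟦ B ⟧ → ∀ J → Dim (B ∧ ⋂ J (λ i → A ÷ a i)) m → n < m ℕ.+ FS.∣ J ∣ →
    HasIndivisibleDegree n
  hall-violation⇒indivisible {A} {B} {n} {m} {a} basis@(li , ⊆A , _) dB 1∉B J dB₀ n<m+∣J∣
    with e-transform (suc (suc m)) ℕₚ.≤-refl dA (dim-SpanOn J a li)
           (snoc dB₀ (step-▹ λ (1∈B , _) → 1∉B 1∈B)) 0<∣J∣ (∈-▹ {B₀}) A₀B₁⊆A
    where
    module A = Subspace A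
    B₀ : Subspace
    B₀ = B ∧ ⋂ J (λ i → A ÷ a i)
    dA : Dim A n
    dA = basis⇒dim basis
    0<∣J∣ : 0 < FS.∣ J ∣
    0<∣J∣ = ℕₚ.+-cancelˡ-< m 0 _ (ℕₚ.≤-<-trans
      (≡.subst (_≤ n) (≡.sym (ℕₚ.+-identityʳ m)) (dim-≤ ∧-⊑ˡ dB₀ dB)) n<m+∣J∣)
    A₀B₁⊆A : ∀ {x y} → x ∈ ⟦ SpanOn J a ⟧ → y ∈ ⟦ B₀ ▹ 1# ⟧ → x * y ∈ ⟦ A ⟧
    A₀B₁⊆A {x} {y} x∈ (v , k , (_ , v∈) , k∈ , y≈) =
      A.resp (*-comm y x) (app (SpanOn-least {A ÷ y} J a λ {i} i∈ →
        A.resp (sym (trans (*-congʳ y≈) (trans (distribʳ (a i) v (k * 1#))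
          (+-cong (*-comm v (a i)) (*-congʳ (*-identityʳ k))))))
          (A.+-closed (v∈ i i∈) (A.*-closed k∈ (⊆A (∈-Span a i))))) x∈)
  ... | S , B′ , s , m′ , dS , dB′ , 0<s , S⊑A , s+m′≡ , SB′⊆S
    with ⊏-witness (nil ⊑-refl ⊑-refl) dS 0<s
  ... | x , x∈S , x∉𝟎
    -- Multiplication by a nonzero x ∈ S embeds the stabilizer into S, which makes it
    -- finite-dimensional with d ≤ s.
    with dim-⊑ {stabilizer S} (incl λ {f} f∈ → Subspace.resp S (*-comm f x) (f∈ x x∈S))
               (dim-÷ {S} {x = x} (λ x≈0 → x∉𝟎 (lift x≈0)) dS)
  ... | d , dF , d≤s =
    ⟦ F ⟧ , d , (isSubfieldF , (K⊆F , F⊈K) , dim⇒basis dF) , ℕₚ.≤-trans d≤s s≤n ,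
    no-next-multiple (degree-∣ {F} isSubfieldF dF (λ f∈ x∈ → f∈ _ x∈) dS) s≤n 2+n≤s+d
    where
    F : Subspace
    F = stabilizer S
    isSubfieldF : IsSubfield ⟦ F ⟧
    isSubfieldF = stabilizer-isSubfield dS
    s≤n : s ≤ n
    s≤n = dim-≤ S⊑A dS (basis⇒dim basis)
    m′≤d : m′ ≤ d
    m′≤d = dim-≤ (incl λ {y} y∈ x x∈ → Subspace.resp S (*-comm x y) (SB′⊆S x∈ y∈)) dB′ dF
    2+n≤s+d : suc (suc n) ≤ s ℕ.+ d
    2+n≤s+d = begin
      suc (suc n)           ≤⟨ s≤s n<m+∣J∣ ⟩
      suc m ℕ.+ FS.∣ J ∣    ≡⟨ ℕₚ.+-comm (suc m) _ ⟩
      FS.∣ J ∣ ℕ.+ suc m    ≡⟨ s+m′≡ ⟨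
      s ℕ.+ m′              ≤⟨ ℕₚ.+-monoʳ-≤ s m′≤d ⟩
      s ℕ.+ d               ∎
      where open ℕₚ.≤-Reasoning
    K⊆F : K ⊆ ⟦ F ⟧
    K⊆F k∈ y y∈ = Subspace.*-closed S k∈ y∈
    -- F ⊆ K would force d ≤ 1 and thus s + d ≤ n + 1.
    F⊈K : ¬ (⟦ F ⟧ ⊆ K)
    F⊈K F⊆K = ℕₚ.<⇒≱ 2+n≤s+d (≡.subst (s ℕ.+ d ≤_) (ℕₚ.+-comm n 1)
      (ℕₚ.+-mono-≤ s≤n (dim-≤ (⊆K⇒⊑K-space {F} F⊆K) dF dim-K-space)))

  unmatchable⇒indivisible : ∀ {A B n} → Dim B n → 1# ∉ ⟦ B ⟧ →
    Unmatchable n ⟦ A ⟧ ⟦ B ⟧ → HasIndivisibleDegree n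
  unmatchable⇒indivisible {A} {B} {n} dB 1∉B unmatchable =
    decidable-stable em λ ¬indivisible → unmatchable (matchable ¬indivisible)
    where
    matchable : ¬ HasIndivisibleDegree n → Matchable n ⟦ A ⟧ ⟦ B ⟧
    matchable ¬indivisible a basis@(li , _) = b , basis′ , λ i ((z , z∈ , y≈) , y∈) →
      app (matched i) (y∈ , Subspace.resp A (sym (trans (*-congˡ y≈)
        (*-⁻¹-cancelˡ z (independent-≉0 a li i)))) z∈)
      where
      hall : Hall n B (λ i → A ÷ a i)
      hall J dB₀ = ℕₚ.≮⇒≥ λ bad →
        ¬indivisible (hall-violation⇒indivisible {A} {B} {a = a} basis dB 1∉B J dB₀ bad)
      result = rado n dB (λ i → A ÷ a i) hall
      b = proj₁ result
      basis′ = proj₁ (proj₂ result)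
      matched = proj₂ (proj₂ result)

  -- Construction of unmatchable pairs

  -- Take a basis a of A extending one of S. If `a i` lies in S, then B₀ ⊆ aᵢ⁻¹A ∩ B, so a match b
  -- keeps B₀ in the span of the bⱼ with j ≠ i. Hence B₀ meets the span of these m vectors `b i`
  -- trivially, and m + l ≤ n.
  unmatchable-pair : ∀ {A B S B₀ j l m n} → j ℕ.+ m ≡ n → Chain S A j → Dim S m →
    Dim B n → B₀ ⊑ B → Dim B₀ l → n < m ℕ.+ l →
    (∀ {x y} → x ∈ ⟦ S ⟧ → y ∈ ⟦ B₀ ⟧ → x * y ∈ ⟦ A ⟧) → Unmatchable n ⟦ A ⟧ ⟦ B ⟧
  unmatchable-pair {A} {B} {S} {B₀} ≡.refl S⋯A dS dB B₀⊑B dB₀ n<m+l SB₀⊆A match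
    with basis-extend S⋯A (proj₂ (dim⇒basis dS))
  ... | a , J , basis-a , ∣J∣≡m , a∈S with match a basis-a
  ... | b , basis-b@(li , ⊆B , _) , matched = contradiction
    (dim-≤ (∨-least (SpanOn-least J b λ {i} _ → ⊆B (∈-Span b i)) B₀⊑B)
      (dim-∨ (≡.subst (Dim (SpanOn J b)) ∣J∣≡m (dim-SpanOn J b li)) dB₀ disjoint) dB)
    (ℕₚ.<⇒≱ n<m+l)
    where
    disjoint : SpanOn J b ∧ B₀ ⊑ 𝟎
    disjoint = incl λ {x} (x∈ , x∈B₀) → SpanOn-disjoint J b li x∈ λ {i} i∈ →
      matched i ((a i * x , SB₀⊆A (a∈S i∈) x∈B₀ ,
        sym (⁻¹-*-cancelˡ x (independent-≉0 a (proj₁ basis-a) i))) , app B₀⊑B x∈B₀)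

  -- Every adjoined vector is new modulo a space containing both T and the current D, so it cannot
  -- bring x ∈ T into D. With x = 1 this gives first B₀ inside F, starting from 𝟎 inside K, and then
  -- B from B₀ inside F.
  extend-avoiding : ∀ {C T W x j m} → Chain T W j → Dim C m → C ⊑ T → x ∈ ⟦ T ⟧ → x ∉ ⟦ C ⟧ →
    ∃ λ D → C ⊑ D × D ⊑ W × x ∉ ⟦ D ⟧ × Dim D (j ℕ.+ m)
  extend-avoiding {C} (nil T⊑W _) dC C⊑T x∈T x∉C = C , ⊑-refl , ⊑-trans C⊑T T⊑W , x∉C , dC
  extend-avoiding {x = x} (snoc {W} {X} c s) dC C⊑T x∈T x∉C with extend-avoiding c dC C⊑T x∈T x∉C
  ... | D , C⊑D , D⊑W , x∉D , dD =
    D ▹ new , ⊑-trans C⊑D ⊑-▹ , ▹-least (⊑-trans D⊑W V⊑W) new∈ ,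
    (λ x∈D▹new → x∉D (avoid x∈D▹new)) ,
    snoc dD (step-▹ λ new∈D → new∉ (app D⊑W new∈D))
    where
    open Step s
    avoid : x ∈ ⟦ D ▹ new ⟧ → x ∈ ⟦ D ⟧
    avoid x∈ = ∈-▹⇒∈ D⊑W new∉ x∈ (app (chain-⊑ c) x∈T)

  𝕌 : Subspace
  𝕌 .Subspace.⟦_⟧ x = Lift (c ⊔ ℓ) ⊤
  𝕌 .Subspace.isSubspace = record
    { resp = λ _ _ → _ ; 0∈ = _ ; +-closed = λ _ _ → _ ; *-closed = λ _ _ → _ }

  module _ {n} (n<[L:K] : ∀ d → HasDim U d → n < d) where

    dim-𝕌 : ∀ {m} → Dim 𝕌 m → n < m
    dim-𝕌 {m} d with dim⇒basis d
    ... | v , li , _ , 𝕌⊆ = n<[L:K] m (v , li , _ , λ _ → 𝕌⊆ _)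

    -- A space of dimension at most n is not all of L, so dimension n + 1 is still within reach.
    extend : ∀ j {V m} → Dim V m → j ℕ.+ m ≤ suc n → ∃ λ W → Chain V W j
    extend 0 {V} _ _ = V , nil ⊑-refl ⊑-refl
    extend (suc j) dV j+m<n with extend j dV (ℕₚ.<⇒≤ j+m<n)
    ... | W , c with ¬⊑⇒∃ {𝕌} {W} (λ 𝕌⊑W →
      ℕₚ.<⇒≱ (dim-𝕌 (chain-respʳ (chain-++ dV c) (incl _) 𝕌⊑W)) (ℕ.s≤s⁻¹ j+m<n))
    ... | x , _ , x∉W = W ▹ x , snoc c (step-▹ x∉W)

    -- With n + 1 = qd + r and 0 < r < d, take A ⊇ S for an F-space S of
    -- dimension qd, and B ⊇ B₀ for a hyperplane B₀ of F avoiding 1: then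
    -- SB₀ ⊆ A while qd + (d - 1) > n.
    unmatchable-over : ∀ {F d} q r → IsSubfield ⟦ F ⟧ → K ⊆ ⟦ F ⟧ → Dim F d →
      suc n ≡ r ℕ.+ q ℕ.* d → 0 < r → r < d → d ≤ n →
      ∃₂ λ A B → Dim A n × Dim B n × 1# ∉ ⟦ B ⟧ × Unmatchable n ⟦ A ⟧ ⟦ B ⟧
    unmatchable-over {F} {d} q (suc r) isSubfieldF K⊆F dF ≡.refl _ r<d d≤n
      with stable-multiple isSubfieldF dF {𝕌} (λ _ _ → _) q
    ... | inj₁ (j , j<q , d𝕌) = contradiction (dim-𝕌 d𝕌) (ℕₚ.≤⇒≯
      (ℕₚ.≤-trans (ℕₚ.*-monoˡ-≤ d (ℕₚ.<⇒≤ j<q)) (ℕₚ.m≤n+m (q ℕ.* d) r)))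
    ... | inj₂ (S , FS⊆S , _ , dS)
      -- The remainder is `suc r`, so n = r + qd: S lacks r dimensions to become A. B₀ will have
      -- dimension d - 1 and lacks n + 1 - d to become B, the codimension of F in an (n +
      -- 1)-dimensional W.
      with extend r dS (ℕₚ.n≤1+n n)
         | extend (suc n ℕ.∸ d) dF (ℕₚ.≤-reflexive (ℕₚ.m∸n+n≡m (ℕₚ.m≤n⇒m≤1+n d≤n)))
         | codim (K⊆⇒K-space⊑ {F} K⊆F) dim-K-space dF
    ... | A , S⋯A | W , F⋯W | j , K⋯F , j+1≡d
      with extend-avoiding K⋯F (nil ⊑-refl ⊑-refl) (𝟎⊑ _) (∈-▹ {𝟎}) (λ (lift 1≈0) → 1≉0 1≈0)
    ... | B₀ , _ , B₀⊑F , 1∉B₀ , dB₀ with ≡.trans (≡.sym j+1≡d) (ℕₚ.+-comm j 1) | ℕₚ.+-identityʳ j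
    ... | ≡.refl | j+0≡j with extend-avoiding F⋯W (≡.subst (Dim B₀) j+0≡j dB₀) B₀⊑F
                                (IsSubfield.1∈ isSubfieldF) 1∉B₀
    ... | B , B₀⊑B , _ , 1∉B , dB =
      A , B , chain-++ dS S⋯A , dB′ , 1∉B ,
      unmatchable-pair ≡.refl S⋯A dS dB′ B₀⊑B (≡.subst (Dim B₀) j+0≡j dB₀)
        (≡.subst (_≤ q ℕ.* suc j ℕ.+ j) (ℕₚ.+-comm (q ℕ.* suc j) (suc r))
          (ℕₚ.+-monoʳ-≤ (q ℕ.* suc j) (ℕ.s≤s⁻¹ r<d)))
        λ {x} {y} x∈ y∈ → app (chain-⊑ S⋯A)
          (Subspace.resp S (*-comm y x) (FS⊆S (app B₀⊑F y∈) x∈))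
      where
      dB′ : Dim B n
      dB′ = ≡.subst (Dim B) (ℕₚ.m∸n+n≡m (ℕ.s≤s⁻¹ (ℕₚ.m≤n⇒m≤1+n d≤n))) dB

    indivisible⇒unmatchable : HasIndivisibleDegree n →
      ∃₂ λ A B → Dim A n × Dim B n × 1# ∉ ⟦ B ⟧ × Unmatchable n ⟦ A ⟧ ⟦ B ⟧
    indivisible⇒unmatchable (F , d , (isSubfieldF , (K⊆F , _) , v , basis-v) , d≤n , d∤1+n) =
      unmatchable-over (suc n / d) (suc n % d) isSubfieldF K⊆F dF
        (m≡m%n+[m/n]*n (suc n) d)
        (ℕₚ.n≢0⇒n>0 λ r≡0 → d∤1+n (m%n≡0⇒n∣m (suc n) d r≡0)) (m%n<n (suc n) d) d≤n
      where
      module F = IsSubfield isSubfieldF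
      F-space : Subspace
      F-space .Subspace.⟦_⟧ = F
      F-space .Subspace.isSubspace = record
        { resp = F.resp ; 0∈ = F.0∈ ; +-closed = F.+-closed
        ; *-closed = λ k∈ → F.*-closed (K⊆F k∈) }
      dF : Dim F-space d
      dF = basis⇒dim basis-v
      instance
        d≢0 : ℕ.NonZero d
        d≢0 = ℕ.>-nonZero (degree>0 {F-space} isSubfieldF dF)

open import Data.Nat.Base using (_+_)
open import Function.Bundles using (_⇔_; mk⇔)

theorem3p10 :
    Classical →
    ∀ {c ℓ} (E : FieldExtension c ℓ) →
    let open FieldExtension E hiding (_+_) in
    K ⊂ U →
    (∃ λ F → F ⊂ U × ∃ λ d → IsProperExtensionOfDegree F d) →
    ∀ (n : ℕ) → 0 < n →
    ∀ (n₀ : ℕ) → IsMinimalDegree n₀ → n₀ ≤ n →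
    (∀ d → HasDim U d → n < d) →
    (∃₂ λ A B → IsSubspace A × HasDim A n ×
                IsSubspace B × HasDim B n ×
                1# ∉ B × Unmatchable n A B)
    ⇔
    (∃ λ F → ∃ λ d → IsProperExtensionOfDegree F d × d ≤ n × d ∤ n + 1)
theorem3p10 em E _ _ n _ _ _ _ n<[L:K] = mk⇔
  (λ (A , B , A-sub , _ , B-sub , (_ , basis-B) , 1∉B , unmatchable) →
    let A′ = record { ⟦_⟧ = A ; isSubspace = A-sub }
        B′ = record { ⟦_⟧ = B ; isSubspace = B-sub }
        (F , d , ext , d≤n , d∤1+n) =
          unmatchable⇒indivisible {A′} {B′} (basis⇒dim basis-B) 1∉B unmatchable
    in F , d , ext , d≤n , ≡.subst (d ∤_) (ℕₚ.+-comm 1 n) d∤1+n)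
  (λ (F , d , ext , d≤n , d∤n+1) →
    let (A , B , dA , dB , 1∉B , unmatchable) = indivisible⇒unmatchable n<[L:K]
          (F , d , ext , d≤n , ≡.subst (d ∤_) (ℕₚ.+-comm n 1) d∤n+1)
    in Subspace.⟦_⟧ A , Subspace.⟦_⟧ B , Subspace.isSubspace A , dim⇒basis dA ,
       Subspace.isSubspace B , dim⇒basis dB , 1∉B , unmatchable)
  where open Subspaces em E
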